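{- Let $G=(V,E)$ be a $3$ edge-connected graph of diameter $D$ with a source node $s$ holding a message $m_0$, where all nodes know a value $D'$ that is a constant-factor upper bound on $D$ (i.e., $D'\in[D,cD]$ for a constant $c\ge 1$). Let $L=7D'$ and suppose the nodes locally know an $(L,1)$ covering family $\mathcal{G}$ of $G$. Then there exists a deterministic algorithm in the adversarial \textsc{CONGEST} model that solves broadcast against a single adversarial edge within $O(\omega(\mathcal{G})\cdot L+|\mathcal{G}|)$ rounds.
   Context: An $(L,k)$ covering family of $G$ is a family of subgraphs $\mathcal{G}=\{G_1,\dots,G_\ell\}$, $G_i\subseteq G$, such that for every $u,v\in V$, every set $E'\subseteq E$ with $|E'|\le k$, and every $u$-$v$ path $P\subseteq G\setminus E'$ of length at most $L$, there is some $G_i$ with $P\subseteq G_i$ and $E'\cap G_i=\emptyset$. An ordered family $\mathcal{G}$ is locally known if, given the identifier of an edge $e=(u,v)$ and an index $i$, the nodes $u,v$ can locally determine whether $e\in G_i$. The width is $\omega(\mathcal{G})=\max_{e\in E}|\{G_i\in\mathcal{G}: e\notin G_i\}|$. Adversarial CONGEST model: $n$-node network $G$, unique $O(\log n)$-bit IDs, each node initially knows its incident edges' identifiers and a polynomial estimate of $n$; synchronous rounds with $O(\log n)$-bit messages per edge per round; a computationally unbounded adaptive adversary, knowing topology, protocol and random coins, controls a fixed unknown set of at most $t$ edges (here $t=1$) and may send arbitrary messages over them (possibly different per direction) based on all communication so far. Broadcast: all nodes must output $m_0$, ignoring all other messages. -}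

module Defs where

open import Data.Nat using (ℕ; zero; suc; _+_; _*_; _^_; _≤_; _⊔_)
open import Data.Nat.Logarithm using (⌊log₂_⌋)
open import Data.Nat.Base using (_<_)
open import Data.Bool using (Bool; true; false; if_then_else_; _∧_; _∨_)
open import Data.Fin using (Fin; _≟_)
open import Data.Fin.Base using () renaming (zero to fzero; suc to fsuc)
open import Data.List using (List; []; _∷_; _++_; [_]; map; foldr; length)
open import Data.List.Base using (allFin)
open import Data.List.Relation.Unary.Linked using (Linked)
open import Data.List.Relation.Unary.Unique.Propositional using (Unique)
open import Data.Maybe using (Maybe; just; nothing)
open import Data.Product using (Σ; ∃; _×_; _,_)
open import Data.Sum using (_⊎_)
open import Data.Unit using (⊤)
open import Relation.Nullary using (¬_; does)
open import Relation.Binary.PropositionalEquality using (_≡_)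

record Graph (n : ℕ) : Set where
  field
    adj     : Fin n → Fin n → Bool
    adj-sym : ∀ u v → adj u v ≡ adj v u
    adj-irr : ∀ u → adj u u ≡ false

Edge : ∀ {n} → Graph n → Fin n → Fin n → Set
Edge G u v = Graph.adj G u v ≡ true

SameEdge : ∀ {n} → Fin n → Fin n → Fin n → Fin n → Set
SameEdge x y a b = (x ≡ a × y ≡ b) ⊎ (x ≡ b × y ≡ a)

endpoint : ∀ {A : Set} → A → List A → A
endpoint u []       = u
endpoint u (y ∷ ys) = endpoint y ys

-- the vertex list u ∷ ys is a walk from u to v using edges of R
-- (it has  length ys  edges)
WalkIn : ∀ {n} → (Fin n → Fin n → Set) → Fin n → Fin n → List (Fin n) → Set
WalkIn R u v ys = Linked R (u ∷ ys) × endpoint u ys ≡ v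

PathIn : ∀ {n} → (Fin n → Fin n → Set) → Fin n → Fin n → List (Fin n) → Set
PathIn R u v ys = WalkIn R u v ys × Unique (u ∷ ys)

Connected : ∀ {n} → (Fin n → Fin n → Set) → Fin n → Fin n → Set
Connected R u v = ∃ λ ys → WalkIn R u v ys

ReachWithin : ∀ {n} → (Fin n → Fin n → Set) → Fin n → Fin n → ℕ → Set
ReachWithin R u v k = ∃ λ ys → WalkIn R u v ys × length ys ≤ k

IsDiameter : ∀ {n} → Graph n → ℕ → Set
IsDiameter {n} G D =
  (∀ (u v : Fin n) → ReachWithin (Edge G) u v D) ×
  (∀ D₀ → (∀ (u v : Fin n) → ReachWithin (Edge G) u v D₀) → D ≤ D₀)

ThreeEdgeConnected : ∀ {n} → Graph n → Set
ThreeEdgeConnected {n} G =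
  ∀ (a b c d u v : Fin n) →
    Connected (λ x y → Edge G x y × ¬ SameEdge x y a b × ¬ SameEdge x y c d) u v

Family : ℕ → ℕ → Set
Family n ℓ = Fin ℓ → Fin n → Fin n → Bool

IsSubgraphFamily : ∀ {n ℓ} → Graph n → Family n ℓ → Set
IsSubgraphFamily G fam =
  (∀ i x y → fam i x y ≡ fam i y x) × (∀ i x y → fam i x y ≡ true → Edge G x y)

-- an edge set E' with |E'| ≤ 1
NotInE' : ∀ {n} → Maybe (Fin n × Fin n) → Fin n → Fin n → Set
NotInE' nothing        x y = ⊤
NotInE' (just (a , b)) x y = ¬ SameEdge x y a b

E'⊆E : ∀ {n} → Graph n → Maybe (Fin n × Fin n) → Set
E'⊆E G nothing        = ⊤
E'⊆E G (just (a , b)) = Edge G a b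

Avoids : ∀ {n} → Maybe (Fin n × Fin n) → (Fin n → Fin n → Bool) → Set
Avoids nothing        g = ⊤
Avoids (just (a , b)) g = g a b ≡ false

IsCovering1 : ∀ {n ℓ} → Graph n → ℕ → Family n ℓ → Set
IsCovering1 {n} {ℓ} G L fam =
  ∀ (u v : Fin n) (E' : Maybe (Fin n × Fin n)) → E'⊆E G E' →
  ∀ (ys : List (Fin n)) →
    PathIn (λ x y → Edge G x y × NotInE' E' x y) u v ys → length ys ≤ L →
    ∃ λ (i : Fin ℓ) → Linked (λ x y → fam i x y ≡ true) (u ∷ ys) × Avoids E' (fam i)

countFalse : ∀ ℓ → (Fin ℓ → Bool) → ℕ
countFalse zero    f = 0
countFalse (suc ℓ) f = (if f fzero then 0 else 1) + countFalse ℓ (λ i → f (fsuc i))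

maxOver : ∀ n → (Fin n → ℕ) → ℕ
maxOver zero    f = 0
maxOver (suc n) f = f fzero ⊔ maxOver n (λ i → f (fsuc i))

width : ∀ {n ℓ} → Graph n → Family n ℓ → ℕ
width {n} {ℓ} G fam =
  maxOver n (λ u → maxOver n (λ v →
    if Graph.adj G u v then countFalse ℓ (λ i → fam i u v) else 0))

-- "x fits in c·(bit length of n)" bits, i.e. x is an O(log n)-bit value

Fits : ℕ → ℕ → ℕ → Set
Fits c n x = x < 2 ^ (c * suc ⌊log₂ n ⌋)

-- messages received in one round: list of (sender ID , message or silence)
RoundMsgs : Set
RoundMsgs = List (ℕ × Maybe ℕ)

History : Set
History = List RoundMsgs

record Input : Set where
  field
    myId     : ℕ
    nEst     : ℕ                     -- polynomial estimate of n
    dEst     : ℕ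
    famSize  : ℕ
    source   : Maybe ℕ               -- just m₀ at the source, nothing elsewhere
    incident : List (ℕ × List Bool)  -- incident edges: neighbour ID and
                                     -- [ e ∈ G_0 , … , e ∈ G_{ℓ-1} ]

record Algorithm : Set where
  field
    -- message to the neighbour with the given ID in the current round
    send   : Input → History → ℕ → Maybe ℕ
    output : Input → History → Maybe ℕ

record Setup (n : ℕ) : Set where
  field
    graph  : Graph n
    ident  : Fin n → ℕ
    nEst   : ℕ
    dEst   : ℕ
    ℓ      : ℕ
    fam    : Family n ℓ
    src    : Fin n
    m₀     : ℕ

-- an adversary controlling at most one (fixed) edge; on that edge it chooses
-- the message delivered in each direction, adaptively, as a function of the
-- round and the full communication history so far
record Adversary (n : ℕ) : Set where
  field
    corrupt  : Maybe (Fin n × Fin n)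
    strategy : ℕ → (Fin n → History) → Fin n → Fin n → Maybe ℕ

ValidAdversary : ∀ {n} → Graph n → Adversary n → Set
ValidAdversary G adv = E'⊆E G (Adversary.corrupt adv)

isCorrupt : ∀ {n} → Maybe (Fin n × Fin n) → Fin n → Fin n → Bool
isCorrupt nothing        u v = false
isCorrupt (just (a , b)) u v =
  (does (u ≟ a) ∧ does (v ≟ b)) ∨ (does (u ≟ b) ∧ does (v ≟ a))

neighbours : ∀ {n} → Graph n → Fin n → List (Fin n)
neighbours {n} G v =
  foldr (λ u acc → if Graph.adj G v u then u ∷ acc else acc) [] (allFin n)

inputOf : ∀ {n} → Setup n → Fin n → Input
inputOf {n} S v = record
  { myId     = ident v
  ; nEst     = nEst
  ; dEst     = dEst
  ; famSize  = ℓ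
  ; source   = if does (v ≟ src) then just m₀ else nothing
  ; incident = map (λ u → ident u , map (λ i → fam i v u) (allFin ℓ))
                   (neighbours graph v)
  }
  where open Setup S

module Run {n : ℕ} (A : Algorithm) (S : Setup n) (adv : Adversary n) where
  open Setup S
  open Adversary adv

  delivered : ℕ → (Fin n → History) → Fin n → Fin n → Maybe ℕ
  delivered r h u v =
    if isCorrupt corrupt u v
      then strategy r h u v
      else Algorithm.send A (inputOf S u) (h u) (ident v)

  -- exec r v : everything node v has received during rounds 0 … r-1
  exec : ℕ → Fin n → History
  exec zero    v = []
  exec (suc r) v =
    exec r v ++ [ map (λ u → ident u , delivered r (exec r) u v) (neighbours graph v) ]

  honestMsg : ℕ → Fin n → Fin n → Maybe ℕ
  honestMsg r u v = Algorithm.send A (inputOf S u) (exec r u) (ident v)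

  out : ℕ → Fin n → Maybe ℕ
  out r v = Algorithm.output A (inputOf S v) (exec r v)

BandwidthOK : ∀ {n} → Algorithm → Setup n → Adversary n → ℕ → Set
BandwidthOK {n} A S adv cB =
  ∀ (r : ℕ) (u v : Fin n) → Edge (Setup.graph S) u v →
    (Run.honestMsg A S adv r u v ≡ nothing) ⊎
    (∃ λ m → Run.honestMsg A S adv r u v ≡ just m × Fits cB n m)

BroadcastWithin : ∀ {n} → Algorithm → Setup n → Adversary n → ℕ → Set
BroadcastWithin {n} A S adv T =
  (∀ (r : ℕ) (v : Fin n) →
     (Run.out A S adv r v ≡ nothing) ⊎ (Run.out A S adv r v ≡ just (Setup.m₀ S))) ×
  (∀ (r : ℕ) (v : Fin n) → T ≤ r → Run.out A S adv r v ≡ just (Setup.m₀ S))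

{-# OPTIONS --safe #-}
module Submission where

-- The source floods m₀ in every G_i at once.  A node holds one report per
-- label i: nothing, a value, or a clash once it has met two different values;
-- reports only grow, are forwarded as they grow, and travel along edges of G_i
-- only.  If the controlled edge e* is not in G_i, all reports on i are below m₀.
-- A node accepts what a neighbour across an edge e claims to have accepted, if
-- it holds that value or a clash on some label i with e ∉ G_i.  This is sound:
-- were e = e*, the flood on i would be clean, so it could not clash and its value
-- would be m₀.  It is also live: for e ≠ e*, three-edge-connectivity gives a path
-- of length at most 5D + 2 from the source to the node that avoids e and e*, and
-- covering it against e gives a label i with e ∉ G_i whose flood runs along the
-- path.  A forged report can turn m₀ into a clash on the way but cannot block it.
--
-- For the time bound, let every edge send any report that is still missing at
-- the other end.  An edge that falls idle has forwarded all reports but those on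
-- the at most ω labels that exclude it, so each hop costs O(ω) rounds beyond the
-- O(ℓ) rounds that it takes to send everything.

open import Defs
open import Algebra.Properties.CommutativeSemigroup using (interchange)
open import Data.Bool using (Bool; true; false; not; if_then_else_; _∨_)
import Data.Bool.Properties as Bool
open import Data.Nat hiding (_⊔_)
open import Data.Nat.DivMod
open import Data.Nat.Logarithm
open import Data.Nat.Properties
open import Data.Nat.Tactic.RingSolver using (solve-∀)
open import Data.Fin using (Fin; zero; suc; toℕ; fromℕ<) renaming (_≟_ to _≟ᶠ_)
open import Data.Fin.Properties using (any?; toℕ-fromℕ<; toℕ<n)
open import Data.List using (List; []; _∷_; allFin; foldl; foldr; length; map; tabulate)
open import Data.List.Properties using (foldl-∷ʳ; map-∘; map-tabulate)
import Data.List.Membership.DecPropositional as DecMembership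
open import Data.List.Membership.Propositional using (_∈_)
open import Data.List.Membership.Propositional.Properties using (∈-allFin)
open import Data.List.Relation.Unary.All as All using (All; []; _∷_)
open import Data.List.Relation.Unary.All.Properties using (¬Any⇒All¬)
open import Data.List.Relation.Unary.AllPairs using ([]; _∷_)
open import Data.List.Relation.Unary.Any using (here; there)
open import Data.List.Relation.Unary.Linked as Linked using (Linked; [-]; _∷_)
open import Data.Maybe using (Maybe; just; nothing)
open import Data.Product using (Σ; ∃; ∃₂; _×_; _,_; proj₁; proj₂)
open import Data.Sum using (_⊎_; inj₁; inj₂)
open import Function using (_∘_; case_of_; id)
open import Function.Definitions using (Injective)
open import Relation.Binary.PropositionalEquality
open import Relation.Nullary using (¬_; Dec; yes; no; does; contradiction)
open import Relation.Nullary.Decidable using (_×-dec_; _⊎-dec_; ¬?; dec-false; dec-true; decidable-stable)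
open import Relation.Unary using (Decidable)

-- The lattice of reports.

data Report : Set where
  none  : Report
  value : ℕ → Report
  clash : Report

infix 4 _⊑_ _⊑?_

-- The flat lattice on the values, with bottom `none` and top `clash`. Its chains have height two,
-- so a growing report changes at most twice; this is where the bound 2 per label comes from.
data _⊑_ : Report → Report → Set where
  none⊑   : ∀ {x} → none ⊑ x
  value⊑  : ∀ {m} → value m ⊑ value m
  ⊑clash  : ∀ {x} → x ⊑ clash

⊑-refl : ∀ {x} → x ⊑ x
⊑-refl {none}    = none⊑
⊑-refl {value _} = value⊑
⊑-refl {clash}   = ⊑clash

⊑-reflexive : ∀ {x y} → x ≡ y → x ⊑ y
⊑-reflexive refl = ⊑-refl

⊑-trans : ∀ {x y z} → x ⊑ y → y ⊑ z → x ⊑ z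
⊑-trans none⊑  _      = none⊑
⊑-trans value⊑ q      = q
⊑-trans ⊑clash ⊑clash = ⊑clash

⊑-antisym : ∀ {x y} → x ⊑ y → y ⊑ x → x ≡ y
⊑-antisym none⊑  none⊑  = refl
⊑-antisym value⊑ _      = refl
⊑-antisym ⊑clash ⊑clash = refl

_⊑?_ : ∀ x y → Dec (x ⊑ y)
none    ⊑? _       = yes none⊑
value _ ⊑? none    = no λ ()
value m ⊑? value k with m ≟ k
... | yes refl = yes value⊑
... | no m≢k   = no λ { value⊑ → m≢k refl }
value _ ⊑? clash   = yes ⊑clash
clash   ⊑? none    = no λ ()
clash   ⊑? value _ = no λ ()
clash   ⊑? clash   = yes ⊑clash

infixr 6 _⊔ʳ_

_⊔ʳ_ : Report → Report → Report
none    ⊔ʳ y       = y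
clash   ⊔ʳ _       = clash
value m ⊔ʳ none    = value m
value m ⊔ʳ clash   = clash
value m ⊔ʳ value k with m ≟ k
... | yes _ = value m
... | no _  = clash

⊔ʳ-upperˡ : ∀ x y → x ⊑ x ⊔ʳ y
⊔ʳ-upperˡ none      y       = none⊑
⊔ʳ-upperˡ (value m) none    = value⊑
⊔ʳ-upperˡ (value m) (value k) with m ≟ k
... | yes refl = value⊑
... | no _     = ⊑clash
⊔ʳ-upperˡ (value m) clash   = ⊑clash
⊔ʳ-upperˡ clash     y       = ⊑clash

⊔ʳ-upperʳ : ∀ x y → y ⊑ x ⊔ʳ y
⊔ʳ-upperʳ none      y       = ⊑-refl
⊔ʳ-upperʳ (value m) none    = none⊑
⊔ʳ-upperʳ (value m) (value k) with m ≟ k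
... | yes refl = value⊑
... | no _     = ⊑clash
⊔ʳ-upperʳ (value m) clash   = ⊑clash
⊔ʳ-upperʳ clash     y       = ⊑clash

⊔ʳ-lub : ∀ {x y z} → x ⊑ z → y ⊑ z → x ⊔ʳ y ⊑ z
⊔ʳ-lub none⊑  q      = q
⊔ʳ-lub value⊑ none⊑  = value⊑
⊔ʳ-lub (value⊑ {m}) value⊑ with m ≟ m
... | yes _  = value⊑
... | no m≢m = contradiction refl m≢m
⊔ʳ-lub ⊑clash _      = ⊑clash

rank : Report → ℕ
rank none      = 0
rank (value _) = 1
rank clash     = 2

rank-mono : ∀ {x y} → x ⊑ y → rank x ≤ rank y
rank-mono none⊑              = z≤n
rank-mono value⊑             = ≤-refl
rank-mono {none}    ⊑clash   = z≤n
rank-mono {value _} ⊑clash   = s≤s z≤n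
rank-mono {clash}   ⊑clash   = ≤-refl

rank≤2 : ∀ x → rank x ≤ 2
rank≤2 x = rank-mono {x} ⊑clash

-- Makes a round in which an edge carries a pending report count: the record of what was sent over
-- that edge rises strictly.
rank-strict : ∀ x y → ¬ (y ⊑ x) → rank x < rank (x ⊔ʳ y)
rank-strict none      none      y⋢x = contradiction none⊑ y⋢x
rank-strict none      (value _) y⋢x = s≤s z≤n
rank-strict none      clash     y⋢x = s≤s z≤n
rank-strict (value m) none      y⋢x = contradiction none⊑ y⋢x
rank-strict (value m) (value k) y⋢x with m ≟ k
... | yes refl = contradiction value⊑ y⋢x
... | no _     = ≤-refl
rank-strict (value m) clash     y⋢x = ≤-refl
rank-strict clash     y         y⋢x = contradiction ⊑clash y⋢x

⨆ : Report → List Report → Report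
⨆ = foldr _⊔ʳ_

-- Finite sums.

∑< : ℕ → (ℕ → ℕ) → ℕ
∑< zero    f = 0
∑< (suc n) f = f 0 + ∑< n (f ∘ suc)

∑-bound : ∀ n {f g} → (∀ j → j < n → f j ≤ g j) → ∑< n f ≤ ∑< n g
∑-bound zero    f≤g = z≤n
∑-bound (suc n) f≤g = +-mono-≤ (f≤g 0 (s≤s z≤n)) (∑-bound n (λ j j<n → f≤g (suc j) (s≤s j<n)))

∑-mono : ∀ n {f g} → (∀ j → f j ≤ g j) → ∑< n f ≤ ∑< n g
∑-mono n f≤g = ∑-bound n (λ j _ → f≤g j)

∑-mono-< : ∀ n {f g} → (∀ j → f j ≤ g j) → ∀ {i} → i < n → f i < g i → ∑< n f < ∑< n g
∑-mono-< (suc n) f≤g {zero}  i<n       fi<gi = +-mono-<-≤ fi<gi (∑-mono n (f≤g ∘ suc))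
∑-mono-< (suc n) f≤g {suc i} (s≤s i<n) fi<gi =
  +-mono-≤-< (f≤g 0) (∑-mono-< n (f≤g ∘ suc) i<n fi<gi)

∑-+ : ∀ n f g → ∑< n (λ j → f j + g j) ≡ ∑< n f + ∑< n g
∑-+ zero    f g = refl
∑-+ (suc n) f g = trans (cong (f 0 + g 0 +_) (∑-+ n (f ∘ suc) (g ∘ suc)))
                        (interchange +-commutativeSemigroup (f 0) (g 0) _ _)

∑-const : ∀ n c → ∑< n (λ _ → c) ≡ n * c
∑-const zero    c = refl
∑-const (suc n) c = cong (c +_) (∑-const n c)

-- A label that excludes an edge can withhold a report of rank at most 2 from it.
cost : Bool → ℕ
cost b = if b then 2 else 0

-- Messages as numbers in base `b`.

module _ (b : ℕ) .{{_ : NonZero b}} where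

  low-digit : ∀ {r} q → r < b → (q * b + r) % b ≡ r
  low-digit {r} q r<b =
    trans (cong (_% b) (+-comm (q * b) r)) (trans ([m+kn]%n≡m%n r q b) (m<n⇒m%n≡m r<b))

  high-digit : ∀ {r} q → r < b → (q * b + r) / b ≡ q
  high-digit {r} q r<b =
    trans (+-distrib-/ (q * b) r
             (subst (_< b) (sym (cong₂ _+_ (m*n%n≡0 q b) (m<n⇒m%n≡m r<b))) r<b))
          (trans (cong₂ _+_ (m*n/n≡m q b) (m<n⇒m/n≡0 r<b)) (+-identityʳ q))

  digits-unique : ∀ {x y x′ y′} → y < b → y′ < b → x * b + y ≡ x′ * b + y′ → x ≡ x′ × y ≡ y′
  digits-unique {x} {y} {x′} {y′} y<b y′<b eq =
      trans (sym (high-digit x y<b)) (trans (cong (_/ b) eq) (high-digit x′ y′<b))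
    , trans (sym (low-digit x y<b)) (trans (cong (_% b) eq) (low-digit x′ y′<b))

digits< : ∀ b {x y Q} → x < Q → y < b → x * b + y < Q * b
digits< b {x} {y} {Q} x<Q y<b = begin-strict
  x * b + y  <⟨ +-monoʳ-< (x * b) y<b ⟩
  x * b + b  ≡⟨ +-comm (x * b) b ⟩
  suc x * b  ≤⟨ *-monoˡ-≤ b x<Q ⟩
  Q * b      ∎
  where open ≤-Reasoning

-- A bijection with the natural numbers, so that any number an adversary delivers decodes to some
-- message whose two reports are digits below `b`.
code : Report → ℕ
code none      = 0
code clash     = 1
code (value m) = 2 + m

uncode : ℕ → Report
uncode 0             = none
uncode 1             = clash
uncode (suc (suc m)) = value m

uncode-code : ∀ x → uncode (code x) ≡ x
uncode-code none      = refl
uncode-code (value _) = refl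
uncode-code clash     = refl

code-uncode : ∀ k → code (uncode k) ≡ k
code-uncode 0             = refl
code-uncode 1             = refl
code-uncode (suc (suc _)) = refl

record Msg : Set where
  constructor ⟨_,_,_⟩
  field
    label  : ℕ
    report : Report
    claim  : Report
open Msg public

module Coding (b : ℕ) .{{_ : NonZero b}} where

  encode : Msg → ℕ
  encode ⟨ j , x , y ⟩ = (j * b + code x) * b + code y

  decode : ℕ → Msg
  decode k = ⟨ k / b / b , uncode (k / b % b) , uncode (k % b) ⟩

  decode-encode : ∀ j {x y} → code x < b → code y < b →
                  decode (encode ⟨ j , x , y ⟩) ≡ ⟨ j , x , y ⟩
  decode-encode j {x} {y} x<b y<b
    rewrite high-digit b (j * b + code x) y<b | low-digit b (j * b + code x) y<b
          | high-digit b j x<b | low-digit b j x<b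
          | uncode-code x | uncode-code y = refl

  report-decode< : ∀ k → code (report (decode k)) < b
  report-decode< k rewrite code-uncode (k / b % b) = m%n<n (k / b) b

  claim-decode< : ∀ k → code (claim (decode k)) < b
  claim-decode< k rewrite code-uncode (k % b) = m%n<n k b

  encode< : ∀ {j N x y} → j < N → code x < b → code y < b → encode ⟨ j , x , y ⟩ < N * b * b
  encode< j<N x<b y<b = digits< b (digits< b j<N x<b) y<b

bitAt : List Bool → ℕ → Bool
bitAt []       _       = true
bitAt (b ∷ _)  zero    = b
bitAt (_ ∷ bs) (suc j) = bitAt bs j

bitsOf : ℕ → List (ℕ × List Bool) → List Bool
bitsOf w []               = []
bitsOf w ((w′ , bs) ∷ es) with w ≟ w′
... | yes _ = bs
... | no _  = bitsOf w es

-- `sent s w j` is the join of all reports on label `j` sent so far to the neighbour with identifier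
-- `w`; comparing it with `known s j` shows what that neighbour may still miss.
record State : Set where
  field
    known    : ℕ → Report
    sent     : ℕ → ℕ → Report
    accepted : Report
open State public

at : ℕ → Msg → Report
at j μ = if does (label μ ≟ j) then report μ else none

-- The protocol

module Protocol (cId cM : ℕ) where

  logEst : Input → ℕ
  logEst I = suc ⌊log₂ Input.nEst I ⌋

  idBound : Input → ℕ
  idBound I = 2 ^ (cId * logEst I)

  -- The summand 2 makes room for the codes of none and clash next to m₀.
  base : Input → ℕ
  base I = 2 ^ (2 + cM * logEst I)

  pairs : Input → ℕ
  pairs I = idBound I * idBound I

  labels : Input → ℕ
  labels I = Input.famSize I ⊓ pairs I

  pairLabel : Input → ℕ → ℕ → ℕ
  pairLabel I x y = x * idBound I + y

  -- A family with too many members for its indices to fit in a message is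
  -- traded for the family G ∖ {e}, whose members are labelled by the pair of
  -- identifiers of e.
  excluded : Input → ℕ → ℕ → Bool
  excluded I w j =
    if does (Input.famSize I ≤? pairs I)
      then not (bitAt (bitsOf w (Input.incident I)) j)
      else does (j ≟ pairLabel I (Input.myId I) w) ∨ does (j ≟ pairLabel I w (Input.myId I))

  module Codec (I : Input) = Coding (base I) {{m^n≢0 2 (2 + cM * logEst I)}}
  open Codec using (encode; decode)

  receive : Input → Maybe ℕ → Msg
  -- Silence, which only the adversary can produce here, reads as a message without content.
  receive I nothing  = ⟨ 0 , none , none ⟩
  receive I (just k) = decode I k

  fromSource : Maybe ℕ → Report
  fromSource (just m) = value m
  fromSource nothing  = none

  initial : Input → State
  initial I = record
    { known    = λ _ → fromSource (Input.source I)
    ; sent     = λ _ _ → none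
    ; accepted = fromSource (Input.source I)
    }

  Pending : Input → State → ℕ → ℕ → Set
  Pending I s w j = excluded I w j ≡ false × ¬ (known s j ⊑ sent s w j)

  pending? : ∀ I s w → Dec (∃ λ j → j < labels I × Pending I s w j)
  pending? I s w =
    anyUpTo? (λ j → (excluded I w j Bool.≟ false) ×-dec ¬? (known s j ⊑? sent s w j)) (labels I)

  -- The claim travels in every message, whether or not a report is pending, so an acceptance is
  -- announced in every later round.
  compose : ∀ {P : ℕ → Set} → State → Dec (∃ P) → Msg
  compose s (yes (j , _)) = ⟨ j , known s j , accepted s ⟩
  compose s (no _)        = ⟨ 0 , none , accepted s ⟩

  outgoing : Input → State → ℕ → Msg
  outgoing I s w = compose s (pending? I s w)

  -- The receiver filters too: a forged message may name any label, and dropping those that exclude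
  -- the edge keeps forgeries out of every flood that avoids it.
  heard : Input → ℕ → ℕ × Maybe ℕ → Report
  heard I j (w , x) = if excluded I w j then none else at j (receive I x)

  Supported : Input → State → ℕ → Report → ℕ → Set
  Supported I s w y j = excluded I w j ≡ true × y ⊑ known s j

  supported? : ∀ I s w y → Dec (∃ λ j → j < labels I × Supported I s w y j)
  supported? I s w y = anyUpTo? (λ j → (excluded I w j Bool.≟ true) ×-dec (y ⊑? known s j)) (labels I)

  vouched : Input → State → ℕ × Maybe ℕ → Report
  vouched I s (w , x) = if does (supported? I s w (claim (receive I x))) then claim (receive I x) else none

  step : Input → State → RoundMsgs → State
  step I s ms = record
    { known    = λ j → ⨆ (known s j) (map (heard I j) ms)
    ; sent     = λ w j → sent s w j ⊔ʳ at j (outgoing I s w)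
    ; accepted = ⨆ (accepted s) (map (vouched I s) ms)
    }

  state : Input → History → State
  state I = foldl (step I) (initial I)

  decision : Report → Maybe ℕ
  decision (value m) = just m
  decision none      = nothing
  decision clash     = nothing

  protocol : Algorithm
  protocol = record
    { send   = λ I h w → just (encode I (outgoing I (state I h) w))
    ; output = λ I h → decision (accepted (state I h))
    }

-- Short detours around two edges

least : ∀ {P : ℕ → Set} → Decidable P → ∀ D → P D →
        ∃ λ d → d ≤ D × P d × (∀ k → k < d → ¬ P k)
least P? zero    p = zero , z≤n , p , λ _ ()
least P? (suc D) p with P? 0
... | yes p₀ = zero , z≤n , p₀ , λ _ ()
... | no ¬p₀ with least (λ k → P? (suc k)) D p
...   | d , d≤D , pd , below =
        suc d , s≤s d≤D , pd , λ { zero _ → ¬p₀ ; (suc k) (s≤s k<d) → below k k<d }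

edge-sym : ∀ {n} (G : Graph n) {u v} → Edge G u v → Edge G v u
edge-sym G e = trans (Graph.adj-sym G _ _) e

sameEdge? : ∀ {n} (x y a b : Fin n) → Dec (SameEdge x y a b)
sameEdge? x y a b = (x ≟ᶠ a ×-dec y ≟ᶠ b) ⊎-dec (x ≟ᶠ b ×-dec y ≟ᶠ a)

sameEdge-flip : ∀ {n} {x y a b : Fin n} → SameEdge y x a b → SameEdge x y a b
sameEdge-flip (inj₁ (p , q)) = inj₂ (q , p)
sameEdge-flip (inj₂ (p , q)) = inj₁ (q , p)

module _ {n : ℕ} where

  data Within (R : Fin n → Fin n → Set) : Fin n → Fin n → ℕ → Set where
    stay : ∀ {u k} → Within R u u k
    move : ∀ {u w v k} → R u w → Within R w v k → Within R u v (suc k)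

  module _ {R : Fin n → Fin n → Set} where

    within-mono : ∀ {u v k l} → k ≤ l → Within R u v k → Within R u v l
    within-mono _         stay       = stay
    within-mono (s≤s k≤l) (move r p) = move r (within-mono k≤l p)

    within-trans : ∀ {u v w k l} → Within R u v k → Within R v w l → Within R u w (k + l)
    within-trans {k = k} stay q = within-mono (m≤n+m _ k) q
    within-trans (move r p)   q = move r (within-trans p q)

    within-sym : (∀ {x y} → R x y → R y x) → ∀ {u v k} → Within R u v k → Within R v u k
    within-sym R-sym stay = stay
    within-sym R-sym {k = suc k} (move r p) =
      subst (Within R _ _) (+-comm k 1) (within-trans (within-sym R-sym p) (move (R-sym r) stay))

    fromReach : ∀ {u v k} → ReachWithin R u v k → Within R u v k
    fromReach ([] , (_ , refl) , _) = stay
    fromReach (_ ∷ ys , (r ∷ rs , e) , s≤s l) = move r (fromReach (ys , (rs , e) , l))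

    exit : ∀ {P : Fin n → Set} → Decidable P → ∀ {u v} → P u → ¬ P v → Connected R u v →
           ∃₂ λ x y → R x y × P x × ¬ P y
    exit {P} P? pu ¬pv (ys , walk) = go pu ¬pv ys walk
      where
      go : ∀ {u v} → P u → ¬ P v → ∀ ys → WalkIn R u v ys → ∃₂ λ x y → R x y × P x × ¬ P y
      go pu ¬pv [] (_ , refl) = contradiction pu ¬pv
      go pu ¬pv (y ∷ ys) (r ∷ rs , e) with P? y
      ... | yes py = go py ¬pv ys (rs , e)
      ... | no ¬py = _ , y , r , pu , ¬py

    path-suffix : ∀ {u y v ys} → u ∈ y ∷ ys → PathIn R y v ys →
                  ∃ λ zs → PathIn R u v zs × length zs ≤ length ys
    path-suffix (here refl) p = _ , p , ≤-refl
    path-suffix {ys = _ ∷ _} (there u∈) ((_ ∷ rs , e) , _ ∷ uniq) with path-suffix u∈ ((rs , e) , uniq)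
    ... | zs , p , l = zs , p , m≤n⇒m≤1+n l

    -- Loop erasure: if the new first vertex already lies on the path, the path is cut back to that
    -- occurrence. Covering families speak of simple paths only.
    toPath : ∀ {u v k} → Within R u v k → ∃ λ ys → PathIn R u v ys × length ys ≤ k
    toPath stay = [] , (([-] , refl) , [] ∷ []) , z≤n
    toPath {u} (move {w = w} r p) with toPath p
    ... | ys , path@((rs , e) , uniq) , l with DecMembership._∈?_ _≟ᶠ_ u (w ∷ ys)
    ...   | yes u∈ with path-suffix u∈ path
    ...     | zs , q , l′ = zs , q , m≤n⇒m≤1+n (≤-trans l′ l)
    toPath {u} (move {w = w} r p) | ys , ((rs , e) , uniq) , l | no u∉ =
      w ∷ ys , ((r ∷ rs , e) , ¬Any⇒All¬ _ u∉ ∷ uniq) , s≤s l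

  within? : (G : Graph n) → ∀ u v k → Dec (Within (Edge G) u v k)
  within? G u v k with u ≟ᶠ v
  ... | yes refl = yes stay
  within? G u v zero    | no u≢v = no λ { stay → u≢v refl }
  within? G u v (suc k) | no u≢v with any? (λ w → (Graph.adj G u w Bool.≟ true) ×-dec within? G w v k)
  ... | yes (w , e , p) = yes (move e p)
  ... | no ¬∃           = no λ { stay → u≢v refl ; (move e p) → ¬∃ (_ , e , p) }

  -- A breadth-first tree towards u falls into at most three parts when two
  -- edges are deleted, each part within distance D of its top vertex: u
  -- itself, or the end of a deleted edge that is farther from u.
  module Detour (G : Graph n) (D : ℕ) (diam : ∀ u v → Within (Edge G) u v D)
                (a b c d : Fin n) where

    R : Fin n → Fin n → Set
    R x y = Edge G x y × ¬ SameEdge x y a b × ¬ SameEdge x y c d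

    R-sym : ∀ {x y} → R x y → R y x
    R-sym (e , p , q) = edge-sym G e , p ∘ sameEdge-flip , q ∘ sameEdge-flip

    module Parts (conn : ∀ u v → Connected R u v) (u : Fin n)
                 (dist : Fin n → ℕ) (dist≤D : ∀ v → dist v ≤ D)
                 (descend : ∀ v → v ≢ u → ∃ λ w → Edge G v w × dist w < dist v) where

      private
        far : Fin n → Fin n → Fin n
        far x y with dist x <? dist y
        ... | yes _ = y
        ... | no _  = x

        -- When the step from `v` down to `w` is a deleted edge, `v` is itself the top of its part.
        far-child : ∀ {v w x y} → SameEdge v w x y → dist w < dist v → far x y ≡ v
        far-child {x = x} {y} s w<v with dist x <? dist y
        far-child (inj₁ (refl , refl)) w<v | yes x<y = contradiction x<y (<-asym w<v)
        far-child (inj₂ (refl , refl)) w<v | yes x<y = refl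
        far-child (inj₁ (refl , refl)) w<v | no x≮y  = refl
        far-child (inj₂ (refl , refl)) w<v | no x≮y  = contradiction w<v x≮y

        centre : Fin 3 → Fin n
        centre zero             = u
        centre (suc zero)       = far a b
        centre (suc (suc zero)) = far c d

        -- Descend towards `u`. Either `u` is reached, or the first deleted edge met ends the
        -- descent at its farther end; each move lowers `dist`, so `k` moves suffice.
        cover : ∀ k v → dist v ≤ k → ∃ λ i → Within R v (centre i) k
        cover k v h with v ≟ᶠ u
        ... | yes refl = zero , stay
        ... | no v≢u with descend v v≢u
        cover zero    v h | no v≢u | w , e , w<v = contradiction (≤-trans w<v h) λ ()
        cover (suc k) v h | no v≢u | w , e , w<v
          with sameEdge? v w a b | sameEdge? v w c d
        ... | yes s | _     = suc zero , subst (λ x → Within R v x (suc k)) (sym (far-child s w<v)) stay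
        ... | no _  | yes s = suc (suc zero) , subst (λ x → Within R v x (suc k)) (sym (far-child s w<v)) stay
        ... | no p  | no q  with cover k w (≤-pred (≤-trans w<v h))
        ...   | i , r = i , move (e , p , q) r

        part : Fin n → Fin 3
        part v = proj₁ (cover D v (dist≤D v))

        part-within : ∀ v → Within R v (centre (part v)) D
        part-within v = proj₂ (cover D v (dist≤D v))

        part-u : part u ≡ zero
        part-u with u ≟ᶠ u
        ... | yes refl = refl
        ... | no u≢u   = contradiction refl u≢u

        hop : ∀ {x y} → R x y → Within R (centre (part x)) (centre (part y)) (D + suc D)
        hop {x} {y} r = within-trans (within-sym R-sym (part-within x)) (move r (part-within y))

        only-two : ∀ {i j k : Fin 3} → i ≢ zero → j ≢ zero → j ≢ i → k ≢ zero → k ≡ i ⊎ k ≡ j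
        only-two {zero} i≢0 _ _ _ = contradiction refl i≢0
        only-two {_} {zero} _ j≢0 _ _ = contradiction refl j≢0
        only-two {_} {_} {zero} _ _ _ k≢0 = contradiction refl k≢0
        only-two {suc zero} {suc zero} _ _ j≢i _ = contradiction refl j≢i
        only-two {suc (suc zero)} {suc (suc zero)} _ _ j≢i _ = contradiction refl j≢i
        only-two {suc zero} {suc (suc zero)} {suc zero} _ _ _ _ = inj₁ refl
        only-two {suc zero} {suc (suc zero)} {suc (suc zero)} _ _ _ _ = inj₂ refl
        only-two {suc (suc zero)} {suc zero} {suc zero} _ _ _ _ = inj₂ refl
        only-two {suc (suc zero)} {suc zero} {suc (suc zero)} _ _ _ _ = inj₁ refl

        -- Take one edge that leaves the part of `v` and one that enters the part of `u`. If the
        -- first does not already reach the part of `u`, it reaches the third part, and the second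
        -- starts either in the part of `v` or in that third part. So two hops between centres
        -- suffice.
        toTop : ∀ {v} → part v ≢ zero → Within R (centre (part v)) u ((D + suc D) + (D + suc D))
        toTop {v} v≢0
          with exit (λ x → part x ≟ᶠ part v) refl (λ eq → v≢0 (trans (sym eq) part-u)) (conn v u)
             | exit (λ x → ¬? (part x ≟ᶠ zero)) v≢0 (λ ≢0 → ≢0 part-u) (conn v u)
        ... | x , y , r , x≡ , y≢ | x′ , y′ , r′ , x′≢0 , ¬y′≢0 with part y ≟ᶠ zero
        ...   | yes y≡0 = within-mono (m≤m+n _ _)
                  (subst₂ (λ i j → Within R (centre i) (centre j) _) x≡ y≡0 (hop r))
        ...   | no y≢0 with only-two v≢0 y≢0 y≢ x′≢0 | decidable-stable (part y′ ≟ᶠ zero) ¬y′≢0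
        ...     | inj₁ x′≡v | y′≡0 = within-mono (m≤m+n _ _)
                  (subst₂ (λ i j → Within R (centre i) (centre j) _) x′≡v y′≡0 (hop r′))
        ...     | inj₂ x′≡y | y′≡0 = within-trans
                  (subst (λ i → Within R (centre i) (centre (part y)) _) x≡ (hop r))
                  (subst₂ (λ i j → Within R (centre i) (centre j) _) x′≡y y′≡0 (hop r′))

      detour : ∀ v → Within R v u (D + ((D + suc D) + (D + suc D)))
      detour v with part v ≟ᶠ zero
      ... | yes v≡0 = within-mono (m≤m+n _ _)
              (subst (λ i → Within R v (centre i) D) v≡0 (part-within v))
      ... | no v≢0  = within-trans (part-within v) (toTop {v} v≢0)

    detour : (∀ u v → Connected R u v) → ∀ v u → Within R v u (D + ((D + suc D) + (D + suc D)))
    detour conn v u = Parts.detour conn u (λ w → proj₁ (nearest w)) (λ w → proj₁ (proj₂ (nearest w))) descend v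
      where
      nearest : ∀ v → ∃ λ k → k ≤ D × Within (Edge G) v u k × (∀ l → l < k → ¬ Within (Edge G) v u l)
      nearest v = least (within? G v u) D (diam v u)

      descend : ∀ v → v ≢ u → ∃ λ w → Edge G v w × proj₁ (nearest w) < proj₁ (nearest v)
      descend v v≢u with nearest v
      ... | _ , _ , stay , _ = contradiction refl v≢u
      ... | suc k , _ , move {w = w} e p , _ =
            w , e , s≤s (≮⇒≥ λ k<dist → proj₂ (proj₂ (proj₂ (nearest w))) k k<dist p)

-- Joins over lists, neighbourhoods and the controlled edge.

⨆-above : ∀ x ys → x ⊑ ⨆ x ys
⨆-above x []       = ⊑-refl
⨆-above x (y ∷ ys) = ⊑-trans (⨆-above x ys) (⊔ʳ-upperʳ y _)

module _ {A : Set} where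

  ⨆-upper : ∀ {f : A → Report} x {a as} → a ∈ as → f a ⊑ ⨆ x (map f as)
  ⨆-upper {f} x {as = a ∷ as} (here refl) = ⊔ʳ-upperˡ (f a) _
  ⨆-upper {f} x {as = a ∷ as} (there a∈)  = ⊑-trans (⨆-upper x a∈) (⊔ʳ-upperʳ (f a) _)

  ⨆-preserves : ∀ {P : Report → Set} → (∀ x y → P x → P y → P (x ⊔ʳ y)) →
                ∀ {x} → P x → ∀ (f : A → Report) {as} → All (λ a → P (f a)) as → P (⨆ x (map f as))
  ⨆-preserves P-⊔ px f []         = px
  ⨆-preserves P-⊔ px f (pa ∷ pas) = P-⊔ _ _ pa (⨆-preserves P-⊔ px f pas)

-- A join of two reports is one of the two or `clash`.
⊔ʳ-preserves : ∀ {P : Report → Set} → P clash → ∀ x y → P x → P y → P (x ⊔ʳ y)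
⊔ʳ-preserves Pc none      y         _  Py = Py
⊔ʳ-preserves Pc clash     y         Px _  = Px
⊔ʳ-preserves Pc (value m) none      Px _  = Px
⊔ʳ-preserves Pc (value m) clash     _  Py = Py
⊔ʳ-preserves Pc (value m) (value k) Px _ with m ≟ k
... | yes _ = Px
... | no _  = Pc

module _ {n : ℕ} (G : Graph n) (v : Fin n) where

  private
    select : List (Fin n) → List (Fin n)
    select = foldr (λ u acc → if Graph.adj G v u then u ∷ acc else acc) []

    select⁺ : ∀ us {u} → Edge G v u → u ∈ us → u ∈ select us
    select⁺ (x ∷ us) e (here refl) rewrite e = here refl
    select⁺ (x ∷ us) e (there u∈) with Graph.adj G v x
    ... | true  = there (select⁺ us e u∈)
    ... | false = select⁺ us e u∈

    select⁻ : ∀ us → All (Edge G v) (select us)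
    select⁻ []       = []
    select⁻ (x ∷ us) with Graph.adj G v x in eq
    ... | true  = eq ∷ select⁻ us
    ... | false = select⁻ us

  ∈-neighbours : ∀ {u} → Edge G v u → u ∈ neighbours G v
  ∈-neighbours e = select⁺ (allFin n) e (∈-allFin _)

  neighbours-edges : All (Edge G v) (neighbours G v)
  neighbours-edges = select⁻ (allFin n)

isCorrupt-sound : ∀ {n} e {u v : Fin n} → isCorrupt e u v ≡ true →
                  ∃ λ a → ∃ λ b → e ≡ just (a , b) × SameEdge u v a b
isCorrupt-sound (just (a , b)) {u} {v} c with u ≟ᶠ a | v ≟ᶠ b | u ≟ᶠ b | v ≟ᶠ a
... | yes p | yes q | _     | _     = a , b , refl , inj₁ (p , q)
... | yes _ | no _  | yes p | yes q = a , b , refl , inj₂ (p , q)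
... | no _  | _     | yes p | yes q = a , b , refl , inj₂ (p , q)

isCorrupt-complete : ∀ {n} {a b u v : Fin n} → ¬ SameEdge u v a b → isCorrupt (just (a , b)) u v ≡ false
isCorrupt-complete {a = a} {b} {u} {v} ¬s with u ≟ᶠ a | v ≟ᶠ b | u ≟ᶠ b | v ≟ᶠ a
... | yes p | yes q | _     | _     = contradiction (inj₁ (p , q)) ¬s
... | yes _ | no _  | yes p | yes q = contradiction (inj₂ (p , q)) ¬s
... | no _  | _     | yes p | yes q = contradiction (inj₂ (p , q)) ¬s
... | yes _ | no _  | yes _ | no _  = refl
... | yes _ | no _  | no _  | _     = refl
... | no _  | _     | yes _ | no _  = refl
... | no _  | _     | no _  | _     = refl

isCorrupt-unique : ∀ {n} e {u v u′ v′ : Fin n} → isCorrupt e u v ≡ true → isCorrupt e u′ v′ ≡ true →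
                   SameEdge u′ v′ u v
isCorrupt-unique e c c′ with isCorrupt-sound e c | isCorrupt-sound e c′
... | _ , _ , refl , inj₁ (refl , refl) | _ , _ , refl , s                  = s
... | _ , _ , refl , inj₂ (refl , refl) | _ , _ , refl , inj₁ (refl , refl) = inj₂ (refl , refl)
... | _ , _ , refl , inj₂ (refl , refl) | _ , _ , refl , inj₂ (refl , refl) = inj₁ (refl , refl)

if⁺ : ∀ {A : Set} (P : Report → Set) (d : Dec A) {x y} → (A → P x) → (¬ A → P y) →
      P (if does d then x else y)
if⁺ P (yes a) px py = px a
if⁺ P (no ¬a) px py = py ¬a

-- Executions

module Execution (cId cM : ℕ) {n : ℕ} (S : Setup n) (adv : Adversary n) where

  open Setup S
  open Protocol cId cM
  open Run protocol S adv

  me : Fin n → Input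
  me = inputOf S

  -- The value of `labels` at every node: it depends only on `ℓ` and `nEst`, which all nodes share.
  -- The same holds for `B` and `base`.
  N : ℕ
  N = ℓ ⊓ (2 ^ (cId * suc ⌊log₂ nEst ⌋) * 2 ^ (cId * suc ⌊log₂ nEst ⌋))

  B : ℕ
  B = 2 ^ (2 + cM * suc ⌊log₂ nEst ⌋)

  ex : Fin n → Fin n → ℕ → Bool
  ex v u = excluded (me v) (ident u)

  letter : ℕ → Fin n → Fin n → ℕ × Maybe ℕ
  letter r v u = ident u , delivered r (exec r) u v

  inbox : ℕ → Fin n → RoundMsgs
  inbox r v = map (letter r v) (neighbours graph v)

  opaque
    st : ℕ → Fin n → State
    st r v = state (me v) (exec r v)

    st-zero : ∀ v → st 0 v ≡ initial (me v)
    st-zero v = refl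

    st-suc : ∀ r v → st (suc r) v ≡ step (me v) (st r v) (inbox r v)
    st-suc r v = foldl-∷ʳ (step (me v)) (initial (me v)) (inbox r v) (exec r v)

  K : ℕ → Fin n → ℕ → Report
  K r v = known (st r v)

  acc : ℕ → Fin n → Report
  acc r v = accepted (st r v)

  msg : ℕ → Fin n → Fin n → Msg
  msg r u v = outgoing (me u) (st r u) (ident v)

  heardFrom : ℕ → Fin n → ℕ → Fin n → Report
  heardFrom r v j u = heard (me v) j (letter r v u)

  vouchedBy : ℕ → Fin n → Fin n → Report
  vouchedBy r v u = vouched (me v) (st r v) (letter r v u)

  K-suc : ∀ r v j → K (suc r) v j ≡ ⨆ (K r v j) (map (heardFrom r v j) (neighbours graph v))
  K-suc r v j = trans (cong (λ s → known s j) (st-suc r v))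
    (cong (⨆ (K r v j)) (sym (map-∘ {g = heard (me v) j} {f = letter r v} (neighbours graph v))))

  acc-suc : ∀ r v → acc (suc r) v ≡ ⨆ (acc r v) (map (vouchedBy r v) (neighbours graph v))
  acc-suc r v = trans (cong accepted (st-suc r v))
    (cong (⨆ (acc r v)) (sym (map-∘ {g = vouched (me v) (st r v)} {f = letter r v} (neighbours graph v))))

  K-mono : ∀ r v j → K r v j ⊑ K (suc r) v j
  K-mono r v j = subst (K r v j ⊑_) (sym (K-suc r v j))
    (⨆-above (K r v j) (map (heardFrom r v j) (neighbours graph v)))

  acc-mono : ∀ r v → acc r v ⊑ acc (suc r) v
  acc-mono r v = subst (acc r v ⊑_) (sym (acc-suc r v))
    (⨆-above (acc r v) (map (vouchedBy r v) (neighbours graph v)))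

  K-heard : ∀ r {v u} j → Edge graph v u → heardFrom r v j u ⊑ K (suc r) v j
  K-heard r {v} {u} j e = subst (heardFrom r v j u ⊑_) (sym (K-suc r v j))
    (⨆-upper {f = heardFrom r v j} (K r v j) (∈-neighbours graph v e))

  acc-vouched : ∀ r {v u} → Edge graph v u → vouchedBy r v u ⊑ acc (suc r) v
  acc-vouched r {v} {u} e = subst (vouchedBy r v u ⊑_) (sym (acc-suc r v))
    (⨆-upper {f = vouchedBy r v} (acc r v) (∈-neighbours graph v e))

  module _ (P : Report → Set) (P-⊔ : ∀ x y → P x → P y → P (x ⊔ʳ y)) where

    K-preserves : ∀ r v j → P (K r v j) →
                  (∀ u → Edge graph v u → P (heardFrom r v j u)) → P (K (suc r) v j)
    K-preserves r v j p q = subst P (sym (K-suc r v j))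
      (⨆-preserves P-⊔ p (heardFrom r v j) (All.map (λ {u} → q u) (neighbours-edges graph v)))

    acc-preserves : ∀ r v → P (acc r v) →
                    (∀ u → Edge graph v u → P (vouchedBy r v u)) → P (acc (suc r) v)
    acc-preserves r v p q = subst P (sym (acc-suc r v))
      (⨆-preserves P-⊔ p (vouchedBy r v) (All.map (λ {u} → q u) (neighbours-edges graph v)))

  mail : ℕ → Fin n → Fin n → Msg
  mail r v u = receive (me v) (delivered r (exec r) u v)

  heard-included : ∀ r {v u j} → ex v u j ≡ false → heardFrom r v j u ≡ at j (mail r v u)
  heard-included r {v} {u} {j} eq = cong (λ b → if b then none else at j (mail r v u)) eq

  heard⁺ : ∀ (P : Report → Set) r v j u → P none → (ex v u j ≡ false → P (at j (mail r v u))) →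
           P (heardFrom r v j u)
  heard⁺ P r v j u Pn Pa = go (ex v u j) Pa
    where
    go : ∀ b → (b ≡ false → P (at j (mail r v u))) → P (if b then none else at j (mail r v u))
    go true  _ = Pn
    go false p = p refl

  vouched⁺ : ∀ (P : Report → Set) r v u → P none →
             (∀ j → j < N → ex v u j ≡ true → claim (mail r v u) ⊑ K r v j → P (claim (mail r v u))) →
             P (vouchedBy r v u)
  vouched⁺ P r v u Pn Pc =
    if⁺ P (supported? (me v) (st r v) (ident u) (claim (mail r v u)))
        (λ (j , j<N , e , s) → Pc j j<N e s) (λ _ → Pn)

  Small : Report → Set
  Small x = code x < B

  0<B : 0 < B
  0<B = m^n>0 2 (2 + cM * suc ⌊log₂ nEst ⌋)

  1<B : 1 < B
  1<B = *-mono-≤ (≤-refl {2}) (m^n>0 2 (1 + cM * suc ⌊log₂ nEst ⌋))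

  start⁺ : ∀ (P : Report → Set) v → P none → P (value m₀) → P (fromSource (Input.source (me v)))
  start⁺ P v Pn Pm with v ≟ᶠ src
  ... | yes _ = Pm
  ... | no _  = Pn

  K-initial : ∀ (P : Report → Set) v j → P none → P (value m₀) → P (K 0 v j)
  K-initial P v j Pn Pm = subst (λ s → P (known s j)) (sym (st-zero v)) (start⁺ P v Pn Pm)

  acc-initial : ∀ (P : Report → Set) v → P none → P (value m₀) → P (acc 0 v)
  acc-initial P v Pn Pm = subst (λ s → P (accepted s)) (sym (st-zero v)) (start⁺ P v Pn Pm)

  source-initial : fromSource (Input.source (me src)) ≡ value m₀
  source-initial with src ≟ᶠ src
  ... | yes _ = refl
  ... | no ¬r = contradiction refl ¬r

  msg⁺ : ∀ (P : Msg → Set) r u v → P ⟨ 0 , none , acc r u ⟩ →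
         (∀ j → j < N → ex u v j ≡ false → ¬ (K r u j ⊑ sent (st r u) (ident v) j) →
            P ⟨ j , K r u j , acc r u ⟩) →
         P (msg r u v)
  msg⁺ P r u v P0 Pj = go (pending? (me u) (st r u) (ident v))
    where
    go : (d : Dec (∃ λ j → j < N × Pending (me u) (st r u) (ident v) j)) → P (compose (st r u) d)
    go (yes (j , j<N , e , p)) = Pj j j<N e p
    go (no _)                  = P0

  msg-claim : ∀ r u v → claim (msg r u v) ≡ acc r u
  msg-claim r u v = msg⁺ (λ μ → claim μ ≡ acc r u) r u v refl λ _ _ _ _ → refl

  at-msg : ∀ r u v j → at j (msg r u v) ≡ none ⊎
           (j < N × ex u v j ≡ false × at j (msg r u v) ≡ K r u j)
  at-msg r u v j = msg⁺ (λ μ → P (at j μ)) r u v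
    (if⁺ P (0 ≟ j) (λ _ → inj₁ refl) (λ _ → inj₁ refl))
    λ i i<N e _ → if⁺ P (i ≟ j) (λ { refl → inj₂ (i<N , e , refl) }) (λ _ → inj₁ refl)
    where
    P : Report → Set
    P x = x ≡ none ⊎ (j < N × ex u v j ≡ false × x ≡ K r u j)

  at-msg⊑K : ∀ r u v j → at j (msg r u v) ⊑ K r u j
  at-msg⊑K r u v j with at-msg r u v j
  ... | inj₁ eq           = subst (_⊑ K r u j) (sym eq) none⊑
  ... | inj₂ (_ , _ , eq) = ⊑-reflexive eq

  Honest : Fin n → Fin n → Set
  Honest u v = isCorrupt (Adversary.corrupt adv) u v ≡ false

  opaque
    unfolding st

    delivered-honest : ∀ r {u v} → Honest u v →
      delivered r (exec r) u v ≡ just (Codec.encode (me u) (msg r u v))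
    delivered-honest r {u} {v} h = cong
      (λ b → if b then Adversary.strategy adv r (exec r) u v
                  else just (Codec.encode (me u) (msg r u v))) h

  receive-small : ∀ I x → code (report (receive I x)) < base I × code (claim (receive I x)) < base I
  receive-small I nothing  = base>0 , base>0
    where base>0 = m^n>0 2 (2 + cM * logEst I)
  receive-small I (just k) = Codec.report-decode< I k , Codec.claim-decode< I k

  mail-small : ∀ r v u → Small (report (mail r v u)) × Small (claim (mail r v u))
  mail-small r v u = receive-small (me v) (delivered r (exec r) u v)

  module _ (m₀-small : Small (value m₀)) where

    -- Forgeries are covered as well: decoding yields only reports with code below `B`, and joins
    -- add nothing but `clash`.
    K-small : ∀ r v j → Small (K r v j)
    K-small zero    v j = K-initial Small v j 0<B m₀-small
    K-small (suc r) v j = K-preserves Small (⊔ʳ-preserves {Small} 1<B) r v j (K-small r v j) λ u _ →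
      heard⁺ Small r v j u 0<B λ _ → if⁺ Small (label (mail r v u) ≟ j) (λ _ → proj₁ (mail-small r v u)) (λ _ → 0<B)

    acc-small : ∀ r v → Small (acc r v)
    acc-small zero    v = acc-initial Small v 0<B m₀-small
    acc-small (suc r) v = acc-preserves Small (⊔ʳ-preserves {Small} 1<B) r v (acc-small r v) λ u _ →
      vouched⁺ Small r v u 0<B λ _ _ _ _ → proj₂ (mail-small r v u)

    msg-small : ∀ r u v → Small (report (msg r u v)) × Small (claim (msg r u v))
    msg-small r u v = msg⁺ (λ μ → Small (report μ) × Small (claim μ)) r u v
      (0<B , acc-small r u) (λ j _ _ _ → K-small r u j , acc-small r u)

    -- Decoding inverts encoding because the reports are small and both ends of the edge compute the
    -- same base.
    mail-honest : ∀ r {u v} → Honest u v → mail r v u ≡ msg r u v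
    mail-honest r {u} {v} h = trans (cong (receive (me v)) (delivered-honest r h)) (
      Codec.decode-encode (me v) (label (msg r u v)) (proj₁ (msg-small r u v)) (proj₂ (msg-small r u v)))

    -- Soundness of acceptance.

    module Sound (ex-sym : ∀ {u v} → Edge graph u v → ∀ {j} → j < N → ex u v j ≡ ex v u j) where

      Clean : ℕ → Set
      Clean j = ∀ u v → Edge graph v u → isCorrupt (Adversary.corrupt adv) u v ≡ true → ex v u j ≡ true

      -- Only one edge is controlled, and its two ends agree on which labels exclude it.
      clean : ∀ {u v j} → Edge graph v u → isCorrupt (Adversary.corrupt adv) u v ≡ true →
              j < N → ex v u j ≡ true → Clean j
      clean e c j<N exj u′ v′ e′ c′ with isCorrupt-unique (Adversary.corrupt adv) c c′
      ... | inj₁ (refl , refl) = exj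
      ... | inj₂ (refl , refl) = trans (ex-sym e′ j<N) exj

      corrupt? : ∀ u v → (isCorrupt (Adversary.corrupt adv) u v ≡ true) ⊎ Honest u v
      corrupt? u v with isCorrupt (Adversary.corrupt adv) u v
      ... | true  = inj₁ refl
      ... | false = inj₂ refl

      -- On a clean label, whatever crosses the controlled edge is dropped, and every other edge
      -- repeats a report that its tail knows.
      K-sound : ∀ r v j → Clean j → K r v j ⊑ value m₀
      K-sound zero    v j _  = K-initial (_⊑ value m₀) v j none⊑ value⊑
      K-sound (suc r) v j cl = K-preserves (_⊑ value m₀) (λ _ _ → ⊔ʳ-lub) r v j (K-sound r v j cl) λ u e →
        heard⁺ (_⊑ value m₀) r v j u none⊑ λ ¬exj → case corrupt? u v of λ where
          (inj₁ c) → contradiction (trans (sym (cl u v e c)) ¬exj) λ ()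
          (inj₂ h) → subst (λ μ → at j μ ⊑ value m₀) (sym (mail-honest r h))
                       (⊑-trans (at-msg⊑K r u v j) (K-sound r u j cl))

      -- A claim over the controlled edge is adopted only with support from a clean label, where
      -- `K-sound` bounds it; any other claim is the sender's own acceptance one round earlier.
      acc-sound : ∀ r v → acc r v ⊑ value m₀
      acc-sound zero    v = acc-initial (_⊑ value m₀) v none⊑ value⊑
      acc-sound (suc r) v = acc-preserves (_⊑ value m₀) (λ _ _ → ⊔ʳ-lub) r v (acc-sound r v) λ u e →
        vouched⁺ (_⊑ value m₀) r v u none⊑ λ j j<N exj s → case corrupt? u v of λ where
          (inj₁ c) → ⊑-trans s (K-sound r v j (clean e c j<N exj))
          (inj₂ h) → subst (λ μ → claim μ ⊑ value m₀) (sym (mail-honest r h))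
                       (subst (_⊑ value m₀) (sym (msg-claim r u v)) (acc-sound r u))

      K-stable : ∀ {r t} → r ≤ t → ∀ v j → K r v j ⊑ K t v j
      K-stable r≤t v j = go (≤⇒≤′ r≤t)
        where
        go : ∀ {r t} → r ≤′ t → K r v j ⊑ K t v j
        go ≤′-refl     = ⊑-refl
        go (≤′-step p) = ⊑-trans (go p) (K-mono _ v j)

      K-source : ∀ t j → value m₀ ⊑ K t src j
      K-source t j = ⊑-trans (⊑-reflexive (sym (trans (cong (λ s → known s j) (st-zero src)) source-initial)))
                             (K-stable z≤n src j)

      acc-stable : ∀ {r t} → r ≤ t → ∀ v → acc r v ⊑ acc t v
      acc-stable r≤t v = go (≤⇒≤′ r≤t)
        where
        go : ∀ {r t} → r ≤′ t → acc r v ⊑ acc t v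
        go ≤′-refl     = ⊑-refl
        go (≤′-step p) = ⊑-trans (go p) (acc-mono _ v)

      acc-source : ∀ t → value m₀ ⊑ acc t src
      acc-source t = ⊑-trans (⊑-reflexive (sym (trans (cong accepted (st-zero src)) source-initial)))
                             (acc-stable z≤n src)

      -- Progress of the floods and of acceptance.

      Sent : ℕ → Fin n → Fin n → ℕ → Report
      Sent t x y = sent (st t x) (ident y)

      Sent-suc : ∀ t x y j → Sent (suc t) x y j ≡ Sent t x y j ⊔ʳ at j (msg t x y)
      Sent-suc t x y j = cong (λ s → sent s (ident y) j) (st-suc t x)

      Sent-mono : ∀ t x y j → Sent t x y j ⊑ Sent (suc t) x y j
      Sent-mono t x y j = subst (Sent t x y j ⊑_) (sym (Sent-suc t x y j)) (⊔ʳ-upperˡ _ _)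

      at-msg⊑K′ : ∀ t {x y} → Edge graph x y → Honest x y → ∀ j → at j (msg t x y) ⊑ K (suc t) y j
      at-msg⊑K′ t {x} {y} e h j with at-msg t x y j
      ... | inj₁ eq            = subst (_⊑ _) (sym eq) none⊑
      ... | inj₂ (j<N , exj , _) = ⊑-trans (⊑-reflexive (sym heard≡)) (K-heard t j (edge-sym graph e))
        where
        heard≡ : heardFrom t y j x ≡ at j (msg t x y)
        heard≡ = trans (heard-included t (trans (sym (ex-sym e j<N)) exj)) (cong (at j) (mail-honest t h))

      -- An honest edge delivers in the same round, and the receiver keeps the report because both
      -- ends agree on the labels excluded.
      Sent⊑K : ∀ t {x y} → Edge graph x y → Honest x y → ∀ j → Sent t x y j ⊑ K t y j
      Sent⊑K zero {x} {y} e h j = subst (λ s → sent s (ident y) j ⊑ K 0 y j) (sym (st-zero x)) none⊑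
      Sent⊑K (suc t) {x} {y} e h j = subst (_⊑ K (suc t) y j) (sym (Sent-suc t x y j))
        (⊔ʳ-lub (⊑-trans (Sent⊑K t e h j) (K-mono t y j)) (at-msg⊑K′ t e h j))

      -- The potential of the time bound: it never falls while reports grow, and never exceeds 2 per
      -- label.
      total : (ℕ → Report) → ℕ
      total f = ∑< N (λ j → rank (f j))

      total-mono : ∀ {f g} → (∀ j → f j ⊑ g j) → total f ≤ total g
      total-mono f⊑g = ∑-mono N (λ j → rank-mono (f⊑g j))

      total≤ : ∀ f → total f ≤ N * 2
      total≤ f = ≤-trans (∑-mono N (λ j → rank≤2 (f j))) (≤-reflexive (∑-const N 2))

      module Transport (W : ℕ) (W-bound : ∀ {x y} → Edge graph x y → ∑< N (λ j → cost (ex x y j)) ≤ W) where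

        Busy Idle : ℕ → Fin n → Fin n → Set
        Busy t x y = total (Sent t x y) < total (Sent (suc t) x y)
        Idle t x y = (∀ j → j < N → ex x y j ≡ false → K t x j ⊑ Sent t x y j) ×
                     total (K t x) ≤ total (Sent t x y) + W

        -- An edge with nothing left to send has forwarded all that its tail
        -- knows, up to the labels that exclude the edge.
        busy-or-idle : ∀ t {x y} → Edge graph x y → Busy t x y ⊎ Idle t x y
        busy-or-idle t {x} {y} e = go (pending? (me x) (st t x) (ident y)) refl
          where
          go : (d : Dec (∃ λ j → j < N × Pending (me x) (st t x) (ident y) j)) →
               compose (st t x) d ≡ msg t x y → Busy t x y ⊎ Idle t x y
          go (yes (i , i<N , _ , K⋢S)) eq =
            inj₁ (∑-mono-< N (λ j → rank-mono (Sent-mono t x y j)) i<N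
              (subst (rank (Sent t x y i) <_) (cong rank (sym new)) (rank-strict _ _ K⋢S)))
            where
            sends : at i (msg t x y) ≡ K t x i
            sends = subst (λ μ → at i μ ≡ K t x i) eq
                      (if⁺ (_≡ K t x i) (i ≟ i) (λ _ → refl) (λ i≢i → contradiction refl i≢i))
            new : Sent (suc t) x y i ≡ Sent t x y i ⊔ʳ K t x i
            new = trans (Sent-suc t x y i) (cong (Sent t x y i ⊔ʳ_) sends)
          go (no ¬p) _ = inj₂ (caught-up , (begin
              total (K t x)                                                ≤⟨ ∑-bound N bound ⟩
              ∑< N (λ j → rank (Sent t x y j) + cost (ex x y j))           ≡⟨ ∑-+ N _ _ ⟩
              total (Sent t x y) + ∑< N (λ j → cost (ex x y j))            ≤⟨ +-monoʳ-≤ _ (W-bound e) ⟩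
              total (Sent t x y) + W                                       ∎))
            where
            open ≤-Reasoning
            caught-up : ∀ j → j < N → ex x y j ≡ false → K t x j ⊑ Sent t x y j
            caught-up j j<N exj =
              decidable-stable (K t x j ⊑? Sent t x y j) λ K⋢S → ¬p (j , j<N , exj , K⋢S)
            bound : ∀ j → j < N → rank (K t x j) ≤ rank (Sent t x y j) + cost (ex x y j)
            bound j j<N with ex x y j in exj
            ... | true  = ≤-trans (rank≤2 (K t x j)) (m≤n+m 2 _)
            ... | false = ≤-trans (rank-mono (caught-up j j<N exj)) (m≤m+n _ 0)

        module _ {j : ℕ} (j<N : j < N) where

          Usable : Fin n → Fin n → Set
          Usable x y = Edge graph x y × Honest x y × ex x y j ≡ false

          -- Until m₀ arrives on j, a node k hops from the source gains a report
          -- per round, up to a lag of k (1 + W) (added on the right, as ∸ truncates).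
          Punctual : Fin n → ℕ → Set
          Punctual x k = ∀ t → value m₀ ⊑ K t x j ⊎ t ≤ total (K t x) + k * suc W

          -- The induction over rounds measures `Sent` on the edge, which lies below what `y` knows.
          -- A busy round raises it by at least one. In an idle round, either `x` has `m₀` on `j`
          -- and has already passed it on, or the punctuality of `x` restores the bound: the edge
          -- withholds at most `W`, and the round itself adds one, hence the lag `suc W` per hop.
          punctual-step : ∀ {x y k} → Usable x y → Punctual x k → Punctual y (suc k)
          punctual-step {x} {y} {k} (e , h , exj) px t with go t
            where
            go : ∀ t → value m₀ ⊑ K t y j ⊎ t ≤ total (Sent t x y) + suc k * suc W
            go zero = inj₂ z≤n
            go (suc t) with go t | busy-or-idle t e
            ... | inj₁ p | _      = inj₁ (⊑-trans p (K-mono t y j))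
            ... | inj₂ q | inj₁ b = inj₂ (≤-trans (s≤s q) (+-monoˡ-≤ _ b))
            ... | inj₂ q | inj₂ (caught-up , idle) with px t
            ...   | inj₁ p =
                    inj₁ (⊑-trans p (⊑-trans (caught-up j j<N exj) (⊑-trans (Sent⊑K t e h j) (K-mono t y j))))
            ...   | inj₂ p = inj₂ (begin
                    suc t                                                ≤⟨ s≤s p ⟩
                    suc (total (K t x) + k * suc W)                      ≤⟨ s≤s (+-monoˡ-≤ _ idle) ⟩
                    suc (total (Sent t x y) + W + k * suc W)             ≡⟨ regroup (total (Sent t x y)) W (k * suc W) ⟩
                    total (Sent t x y) + (suc W + k * suc W)             ≤⟨ +-monoˡ-≤ _ (total-mono (Sent-mono t x y)) ⟩
                    total (Sent (suc t) x y) + suc k * suc W             ∎)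
              where
              open ≤-Reasoning
              regroup : ∀ a b c → suc (a + b + c) ≡ a + (suc b + c)
              regroup = solve-∀
          ... | inj₁ p = inj₁ p
          ... | inj₂ q = inj₂ (≤-trans q (+-monoˡ-≤ _ (total-mono (Sent⊑K t e h))))

          punctual-walk : ∀ {x} ys {k} → Linked Usable (x ∷ ys) → Punctual x k →
                          Punctual (endpoint x ys) (length ys + k)
          punctual-walk []       _        p = p
          punctual-walk (y ∷ ys) {k} (u ∷ us) p =
            subst (Punctual (endpoint y ys)) (+-suc (length ys) k) (punctual-walk ys us (punctual-step {k = k} u p))

          -- The source is punctual with lag 0, as it holds `m₀` from the start. At the end of the
          -- walk, one round beyond `N * 2` plus the lag exceeds what the potential can reach, so
          -- `m₀` must have arrived.
          arrival : ∀ {y ys L} → WalkIn Usable src y ys → length ys ≤ L →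
                    ∀ {t} → suc (N * 2 + L * suc W) ≤ t → value m₀ ⊑ K t y j
          arrival {y} {ys} {L} (us , refl) l {t} T≤t
            with punctual-walk ys {0} us (λ t → inj₁ (K-source t j)) t
          ... | inj₁ p = p
          ... | inj₂ q = contradiction (≤-trans T≤t (≤-trans q
                  (+-mono-≤ (total≤ (K t y))
                    (*-monoˡ-≤ (suc W) (≤-trans (≤-reflexive (+-identityʳ (length ys))) l)))))
                  1+n≰n

        module Accept (L : ℕ)
          (routes : ∀ {x y} → Edge graph x y →
            ∃ λ j → Σ (j < N) λ j<N → ex y x j ≡ true × (∃ λ ys → WalkIn (Usable j<N) src y ys × length ys ≤ L)) where

          T₁ : ℕ
          T₁ = suc (N * 2 + L * suc W)

          -- From `T₁` on, the label given by `routes` holds at least `m₀` at `y` and excludes the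
          -- edge, so it supports the claim, which by `acc-sound` is exactly `m₀`. As `T₁` serves
          -- all edges at once, acceptance then advances one hop per round.
          accept-step : ∀ {x y t} → T₁ ≤ t → Edge graph x y → Honest x y →
                        value m₀ ⊑ acc t x → value m₀ ⊑ acc (suc t) y
          accept-step {x} {y} {t} T≤t e h a with routes e
          ... | j , j<N , exj , ys , w , l = ⊑-trans (⊑-reflexive (sym vouched≡)) (acc-vouched t (edge-sym graph e))
            where
            claim≡ : claim (mail t y x) ≡ value m₀
            claim≡ = trans (cong claim (mail-honest t h))
                       (trans (msg-claim t x y) (⊑-antisym (acc-sound t x) a))
            vouched≡ : vouchedBy t y x ≡ value m₀
            vouched≡ = if⁺ (_≡ value m₀) (supported? (me y) (st t y) (ident x) (claim (mail t y x)))
              (λ _ → claim≡)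
              (λ ¬s → contradiction (j , j<N , exj , subst (_⊑ K t y j) (sym claim≡) (arrival j<N w l T≤t)) ¬s)

          accept-walk : ∀ {x} ys {t} → Linked (λ x y → Edge graph x y × Honest x y) (x ∷ ys) →
                        T₁ ≤ t → value m₀ ⊑ acc t x → value m₀ ⊑ acc (length ys + t) (endpoint x ys)
          accept-walk []       _              _   a = a
          accept-walk {x} (y ∷ ys) {t} ((e , h) ∷ us) T≤t a =
            subst (λ s → value m₀ ⊑ acc s (endpoint y ys)) (+-suc (length ys) t)
              (accept-walk ys us (m≤n⇒m≤1+n T≤t) (accept-step T≤t e h a))

-- Labels

n<2^suc⌊log₂n⌋ : ∀ n → n < 2 ^ suc ⌊log₂ n ⌋
n<2^suc⌊log₂n⌋ n = ≰⇒> λ le →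
  1+n≰n (subst (_≤ ⌊log₂ n ⌋) (⌊log₂[2^n]⌋≡n (suc ⌊log₂ n ⌋)) (⌊log₂⌋-mono-≤ le))

-- A polynomial estimate of `n` is longer in binary by a constant factor only, which keeps messages
-- at O(log n) bits.
suc⌊log₂[n^k]⌋ : ∀ n k → suc ⌊log₂ n ^ k ⌋ ≤ suc ⌊log₂ n ⌋ * suc k
suc⌊log₂[n^k]⌋ n k = begin
  suc ⌊log₂ n ^ k ⌋                          ≤⟨ s≤s (⌊log₂⌋-mono-≤ (^-monoˡ-≤ k (<⇒≤ (n<2^suc⌊log₂n⌋ n)))) ⟩
  suc ⌊log₂ (2 ^ λn) ^ k ⌋                   ≡⟨ cong (λ m → suc ⌊log₂ m ⌋) (^-*-assoc 2 λn k) ⟩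
  suc ⌊log₂ 2 ^ (λn * k) ⌋                   ≡⟨ cong suc (⌊log₂[2^n]⌋≡n (λn * k)) ⟩
  suc (λn * k)                               ≤⟨ +-monoˡ-≤ (λn * k) {1} {λn} (s≤s z≤n) ⟩
  λn + λn * k                                ≡⟨ *-suc λn k ⟨
  λn * suc k                                 ∎
  where
  open ≤-Reasoning
  λn : ℕ
  λn = suc ⌊log₂ n ⌋

if-yes : ∀ {A B : Set} (d : Dec A) {x y : B} → A → (if does d then x else y) ≡ x
if-yes d {x} {y} a = cong (λ b → if b then x else y) (dec-true d a)

if-no : ∀ {A B : Set} (d : Dec A) {x y : B} → ¬ A → (if does d then x else y) ≡ y
if-no d {x} {y} ¬a = cong (λ b → if b then x else y) (dec-false d ¬a)

bitAt-map : ∀ ℓ (f : Fin ℓ → Bool) i → bitAt (map f (allFin ℓ)) (toℕ i) ≡ f i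
bitAt-map ℓ f i = trans (cong (λ bs → bitAt bs (toℕ i)) (map-tabulate id f)) (bitAt-tabulate f i)
  where
  bitAt-tabulate : ∀ {ℓ} (f : Fin ℓ → Bool) i → bitAt (tabulate f) (toℕ i) ≡ f i
  bitAt-tabulate f zero    = refl
  bitAt-tabulate f (suc i) = bitAt-tabulate (f ∘ suc) i

bitsOf-map : ∀ {n} {ident : Fin n → ℕ} → Injective _≡_ _≡_ ident → ∀ (f : Fin n → List Bool) {us u} →
             u ∈ us → bitsOf (ident u) (map (λ w → ident w , f w) us) ≡ f u
bitsOf-map {ident = ident} inj f {w ∷ us} {u} u∈ with ident u ≟ ident w
... | yes eq = cong f (sym (inj eq))
bitsOf-map inj f {w ∷ us} (here refl) | no ≢  = contradiction refl ≢
bitsOf-map inj f {w ∷ us} (there u∈)  | no ≢  = bitsOf-map inj f u∈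

≤-maxOver : ∀ n (f : Fin n → ℕ) i → f i ≤ maxOver n f
≤-maxOver (suc n) f zero    = m≤m⊔n (f zero) _
≤-maxOver (suc n) f (suc i) = ≤-trans (≤-maxOver n (f ∘ suc) i) (m≤n⊔m (f zero) _)

countFalse≤width : ∀ {n ℓ} (G : Graph n) (fam : Family n ℓ) {u v} → Edge G u v →
                   countFalse ℓ (λ i → fam i u v) ≤ width G fam
countFalse≤width {n} G fam {u} {v} e = ≤-trans
  (≤-reflexive (sym (cong (λ b → if b then countFalse _ (λ i → fam i u v) else 0) e)))
  (≤-trans (≤-maxOver n _ v) (≤-maxOver n (λ u → maxOver n _) u))

countFalse>0 : ∀ ℓ (f : Fin ℓ → Bool) i → f i ≡ false → 1 ≤ countFalse ℓ f
countFalse>0 (suc ℓ) f zero    eq rewrite eq = s≤s z≤n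
countFalse>0 (suc ℓ) f (suc i) eq = ≤-trans (countFalse>0 ℓ (f ∘ suc) i eq) (m≤n+m _ _)

∑-countFalse : ∀ ℓ (f : Fin ℓ → Bool) (g : ℕ → Bool) → (∀ i → g (toℕ i) ≡ not (f i)) →
               ∑< ℓ (λ j → cost (g j)) ≡ countFalse ℓ f * 2
∑-countFalse zero    f g eq = refl
∑-countFalse (suc ℓ) f g eq with f zero | eq zero
... | true  | g0 rewrite g0 = ∑-countFalse ℓ (f ∘ suc) (g ∘ suc) (eq ∘ suc)
... | false | g0 rewrite g0 = cong (2 +_) (∑-countFalse ℓ (f ∘ suc) (g ∘ suc) (eq ∘ suc))

∑-single : ∀ n k → ∑< n (λ j → cost (does (j ≟ k))) ≤ 2
∑-single zero    k       = z≤n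
∑-single (suc n) zero    = ≤-reflexive (cong (2 +_) (trans (∑-const n 0) (*-zeroʳ n)))
∑-single (suc n) (suc k) = ∑-single n k

cost-∨ : ∀ a b → cost (a ∨ b) ≤ cost a + cost b
cost-∨ true  b = s≤s (s≤s z≤n)
cost-∨ false b = ≤-refl

module Labels (cId cM : ℕ) {n : ℕ} (S : Setup n) (adv : Adversary n)
  (ident-inj : Injective _≡_ _≡_ (Setup.ident S))
  (subgraphs : IsSubgraphFamily (Setup.graph S) (Setup.fam S))
  (covering  : IsCovering1 (Setup.graph S) (7 * Setup.dEst S) (Setup.fam S))
  where

  open Setup S
  open Protocol cId cM
  open Execution cId cM S adv

  ω L Q : ℕ
  ω = width graph fam
  L = 7 * dEst
  Q = 2 ^ (cId * suc ⌊log₂ nEst ⌋)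

  trivial-path : ∀ u {R : Fin n → Fin n → Set} → PathIn R u u []
  trivial-path u = ([-] , refl) , ([] ∷ [])

  -- Covering the one-vertex path at `x` against the edge yields a member that omits the edge. This
  -- absorbs terms without a factor `ω` into multiples of `ω`.
  1≤ω : ∀ {x y} → Edge graph x y → 1 ≤ ω
  1≤ω {x} {y} e with covering x x (just (x , y)) e [] (trivial-path x) z≤n
  ... | i , _ , eq = ≤-trans (countFalse>0 ℓ (λ i → fam i x y) i eq) (countFalse≤width graph fam e)

  -- All that the analysis asks of the labels, so that it treats the given family (`Few`) and its
  -- replacement by pairs of identifiers (`Many`) alike.
  record Labelling : Set where
    field
      symmetric : ∀ {u v} → Edge graph u v → ∀ {j} → j < N → ex u v j ≡ ex v u j
      narrow    : ∀ {x y} → Edge graph x y → ∑< N (λ j → cost (ex x y j)) ≤ 4 * ω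
      separates : ∀ {x y} → Edge graph x y → ∀ {u v ys} →
                  PathIn (λ p q → Edge graph p q × ¬ SameEdge p q x y) u v ys → length ys ≤ L →
                  ∃ λ j → j < N × ex y x j ≡ true × Linked (λ p q → ex p q j ≡ false) (u ∷ ys)

  module Few (ℓ≤ : ℓ ≤ Q * Q) where

    N≡ℓ : N ≡ ℓ
    N≡ℓ = m≤n⇒m⊓n≡m ℓ≤

    ex-fam : ∀ {v u} → Edge graph v u → ∀ i → ex v u (toℕ i) ≡ not (fam i v u)
    ex-fam {v} {u} e i =
      trans (if-yes (ℓ ≤? Q * Q) ℓ≤)
      (cong not (trans
        (cong (λ bs → bitAt bs (toℕ i))
          (bitsOf-map ident-inj (λ w → map (λ i → fam i v w) (allFin ℓ)) (∈-neighbours graph v e)))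
        (bitAt-map ℓ (λ i → fam i v u) i)))

    labelling : Labelling
    labelling = record
      { symmetric = λ {u} {v} e {j} j<N →
          let i = fromℕ< (subst (j <_) N≡ℓ j<N) in
          subst (λ j → ex u v j ≡ ex v u j) (toℕ-fromℕ< (subst (j <_) N≡ℓ j<N))
            (trans (ex-fam e i) (trans (cong not (proj₁ subgraphs i u v)) (sym (ex-fam (edge-sym graph e) i))))
      ; narrow = λ {x} {y} e → begin
          ∑< N (λ j → cost (ex x y j))   ≡⟨ cong (λ N → ∑< N (λ j → cost (ex x y j))) N≡ℓ ⟩
          ∑< ℓ (λ j → cost (ex x y j))   ≡⟨ ∑-countFalse ℓ (λ i → fam i x y) (ex x y) (ex-fam e) ⟩
          countFalse ℓ (λ i → fam i x y) * 2  ≤⟨ *-monoˡ-≤ 2 (countFalse≤width graph fam e) ⟩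
          ω * 2                          ≡⟨ *-comm ω 2 ⟩
          2 * ω                          ≤⟨ *-monoˡ-≤ ω {2} {4} (s≤s (s≤s z≤n)) ⟩
          4 * ω                          ∎
      ; separates = λ {x} {y} e {u} {v} {ys} path l →
          let i , within , avoids = covering u v (just (x , y)) e ys path l in
          toℕ i , subst (toℕ i <_) (sym N≡ℓ) (toℕ<n i)
          , trans (ex-fam (edge-sym graph e) i) (cong not (trans (proj₁ subgraphs i y x) avoids))
          , Linked.map (λ {p} {q} f → trans (ex-fam (proj₂ subgraphs i p q f) i) (cong not f)) within
      }
      where open ≤-Reasoning

  -- There are fewer pairs of identifiers than members of the family, so a time bound in `N` remains
  -- a bound in `ℓ`.
  module Many (ident< : ∀ v → ident v < Q) (¬ℓ≤ : ¬ ℓ ≤ Q * Q) where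

    N≡Q*Q : N ≡ Q * Q
    N≡Q*Q = m≥n⇒m⊓n≡n (<⇒≤ (≰⇒> ¬ℓ≤))

    lab : Fin n → Fin n → ℕ
    lab x y = ident x * Q + ident y

    lab-injective : ∀ {x y x′ y′} → lab x y ≡ lab x′ y′ → x ≡ x′ × y ≡ y′
    lab-injective eq with digits-unique Q {{m^n≢0 2 (cId * suc ⌊log₂ nEst ⌋)}} (ident< _) (ident< _) eq
    ... | p , q = ident-inj p , ident-inj q

    ex-pair : ∀ v u j → ex v u j ≡ does (j ≟ lab v u) ∨ does (j ≟ lab u v)
    ex-pair v u j = if-no (ℓ ≤? Q * Q) ¬ℓ≤

    labelling : Labelling
    labelling = record
      { symmetric = λ {u} {v} e {j} j<N →
          trans (ex-pair u v j) (trans (Bool.∨-comm (does (j ≟ lab u v)) _) (sym (ex-pair v u j)))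
      -- An edge is excluded by at most two labels, one for each order of its ends, at cost 2 each;
      -- `1≤ω` makes the sum a multiple of `ω`.
      ; narrow = λ {x} {y} e → begin
          ∑< N (λ j → cost (ex x y j))
            ≤⟨ ∑-mono N (λ j → ≤-trans (≤-reflexive (cong cost (ex-pair x y j))) (cost-∨ (does (j ≟ lab x y)) _)) ⟩
          ∑< N (λ j → cost (does (j ≟ lab x y)) + cost (does (j ≟ lab y x)))
            ≡⟨ ∑-+ N _ _ ⟩
          ∑< N (λ j → cost (does (j ≟ lab x y))) + ∑< N (λ j → cost (does (j ≟ lab y x)))
            ≤⟨ +-mono-≤ (∑-single N (lab x y)) (∑-single N (lab y x)) ⟩
          4 * 1
            ≤⟨ *-monoʳ-≤ 4 (1≤ω e) ⟩
          4 * ω ∎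
      ; separates = λ {x} {y} e {u} {v} {ys} path l →
          lab y x , subst (lab y x <_) (sym N≡Q*Q) (digits< Q (ident< y) (ident< x))
          , trans (ex-pair y x (lab y x)) (cong (_∨ does (lab y x ≟ lab x y)) (dec-true (lab y x ≟ lab y x) refl))
          , Linked.map (λ {p} {q} (_ , ¬s) → trans (ex-pair p q (lab y x)) (cong₂ _∨_
              (dec-false (lab y x ≟ lab p q)
                λ eq → case lab-injective eq of λ { (refl , refl) → ¬s (inj₂ (refl , refl)) })
              (dec-false (lab y x ≟ lab q p)
                λ eq → case lab-injective eq of λ { (refl , refl) → ¬s (inj₁ (refl , refl)) })))
            (proj₁ (proj₁ path))
      }
      where open ≤-Reasoning

  labelling : (∀ v → ident v < Q) → Labelling
  labelling ident< with ℓ ≤? Q * Q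
  ... | yes ℓ≤ = Few.labelling ℓ≤
  ... | no ¬ℓ≤ = Many.labelling ident< ¬ℓ≤

-- Bandwidth, correctness and running time.

module Correct (cId cEst cM : ℕ) {n : ℕ} (S : Setup n) (D : ℕ) (adv : Adversary n)
  (3-connected : ThreeEdgeConnected (Setup.graph S))
  (diameter    : IsDiameter (Setup.graph S) D)
  (D≤dEst      : D ≤ Setup.dEst S)
  (ident-inj   : Injective _≡_ _≡_ (Setup.ident S))
  (ident-fits  : ∀ v → Fits cId n (Setup.ident S v))
  (n≤nEst      : n ≤ Setup.nEst S)
  (nEst≤       : Setup.nEst S ≤ n ^ cEst)
  (m₀-fits     : Fits cM n (Setup.m₀ S))
  (subgraphs   : IsSubgraphFamily (Setup.graph S) (Setup.fam S))
  (covering    : IsCovering1 (Setup.graph S) (7 * Setup.dEst S) (Setup.fam S))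
  where

  open Setup S
  open Protocol cId cM
  open Run protocol S adv
  open Execution cId cM S adv
  open Labels cId cM S adv ident-inj subgraphs covering

  -- A label below `Q * Q` takes `2 * cId * λE` bits and each of the two reports `2 + cM * λE`; the
  -- constant 4 becomes `4 * λE`, and `suc cEst` converts `λE` to `λn`.
  λn λE cB : ℕ
  λn = suc ⌊log₂ n ⌋
  λE = suc ⌊log₂ nEst ⌋
  cB = (2 * cId + 2 * cM + 4) * suc cEst

  λn≤λE : λn ≤ λE
  λn≤λE = s≤s (⌊log₂⌋-mono-≤ n≤nEst)

  λE≤ : λE ≤ λn * suc cEst
  λE≤ = ≤-trans (s≤s (⌊log₂⌋-mono-≤ nEst≤)) (suc⌊log₂[n^k]⌋ n cEst)

  ident< : ∀ v → ident v < Q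
  ident< v = ≤-trans (ident-fits v) (^-monoʳ-≤ 2 (*-monoʳ-≤ cId λn≤λE))

  m₀-small : Small (value m₀)
  m₀-small = begin-strict
    2 + m₀               <⟨ +-monoʳ-< 2 (≤-trans m₀-fits (^-monoʳ-≤ 2 (*-monoʳ-≤ cM λn≤λE))) ⟩
    2 + X                ≤⟨ +-monoˡ-≤ X (*-monoʳ-≤ 2 {1} {X} (m^n>0 2 (cM * λE))) ⟩
    2 * X + X            ≤⟨ +-monoʳ-≤ (2 * X) (m≤m+n X (X + 0)) ⟩
    2 * X + 2 * X        ≡⟨ cong (2 * X +_) (+-identityʳ (2 * X)) ⟨
    2 ^ (2 + cM * λE)    ∎
    where
    open ≤-Reasoning
    X : ℕ
    X = 2 ^ (cM * λE)

  open Labelling (labelling ident<)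
  open Sound m₀-small symmetric

  ℓ>0 : 0 < ℓ
  ℓ>0 with covering src src nothing _ [] (trivial-path src) z≤n
  ... | i , _ = ≤-trans (s≤s z≤n) (toℕ<n i)

  N>0 : 0 < N
  N>0 = ⊓-glb ℓ>0 (*-mono-≤ Q>0 Q>0)
    where
    Q>0 : 0 < Q
    Q>0 = m^n>0 2 (cId * λE)

  opaque
    unfolding st

    honestMsg≡ : ∀ r u v → honestMsg r u v ≡ just (Codec.encode (me u) (msg r u v))
    honestMsg≡ r u v = refl

    out≡ : ∀ r v → out r v ≡ decision (acc r v)
    out≡ r v = refl

  capacity : N * B * B ≤ 2 ^ (cB * λn)
  capacity = begin
    N * B * B                                        ≤⟨ *-monoˡ-≤ B (*-monoˡ-≤ B (m⊓n≤n ℓ (Q * Q))) ⟩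
    Q * Q * B * B                                    ≡⟨ cong (λ x → x * B * B) (^-distribˡ-+-* 2 p p) ⟨
    2 ^ (p + p) * B * B                              ≡⟨ cong (_* B) (^-distribˡ-+-* 2 (p + p) q) ⟨
    2 ^ (p + p + q) * B                              ≡⟨ ^-distribˡ-+-* 2 (p + p + q) q ⟨
    2 ^ (p + p + q + q)                              ≤⟨ ^-monoʳ-≤ 2 exponent ⟩
    2 ^ (cB * λn)                                    ∎
    where
    open ≤-Reasoning
    p q : ℕ
    p = cId * λE
    q = 2 + cM * λE
    collect : ∀ a b e → a * e + a * e + (2 + b * e) + (2 + b * e) ≡ (2 * a + 2 * b) * e + 4 * 1
    collect = solve-∀
    rotate : ∀ a b c → a * (b * c) ≡ a * c * b
    rotate = solve-∀
    exponent : p + p + q + q ≤ cB * λn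
    exponent = begin
      p + p + q + q                                  ≡⟨ collect cId cM λE ⟩
      (2 * cId + 2 * cM) * λE + 4 * 1                ≤⟨ +-monoʳ-≤ _ (*-monoʳ-≤ 4 {1} {λE} (s≤s z≤n)) ⟩
      (2 * cId + 2 * cM) * λE + 4 * λE               ≡⟨ *-distribʳ-+ λE (2 * cId + 2 * cM) 4 ⟨
      (2 * cId + 2 * cM + 4) * λE                    ≤⟨ *-monoʳ-≤ (2 * cId + 2 * cM + 4) λE≤ ⟩
      (2 * cId + 2 * cM + 4) * (λn * suc cEst)       ≡⟨ rotate (2 * cId + 2 * cM + 4) λn (suc cEst) ⟩
      cB * λn                                        ∎

  bandwidth : BandwidthOK protocol S adv cB
  bandwidth r u v _ = inj₂ (_ , honestMsg≡ r u v , <-≤-trans encode<NBB capacity)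
    where
    encode<NBB : Codec.encode (me u) (msg r u v) < N * B * B
    encode<NBB = msg⁺ (λ μ → Codec.encode (me u) μ < N * B * B) r u v
      (Codec.encode< (me u) {x = none} {y = acc r u} N>0 0<B (acc-small m₀-small r u))
      (λ j j<N _ _ → Codec.encode< (me u) {x = K r u j} {y = acc r u} j<N
         (K-small m₀-small r u j) (acc-small m₀-small r u))

  -- A walk of length 0 would make the edge a loop. So a path with an edge forces `D` to be
  -- positive, and the detour bound 5D + 2 is at most 7D.
  D≡0⇒edgeless : D ≡ 0 → ∀ {u v} → ¬ Edge graph u v
  D≡0⇒edgeless refl {u} {v} e with proj₁ diameter u v
  ... | [] , (_ , refl) , _ = contradiction (trans (sym e) (Graph.adj-irr graph u)) λ ()

  module _ (a b c d : Fin n) where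

    Avoiding : Fin n → Fin n → Set
    Avoiding x y = Edge graph x y × ¬ SameEdge x y a b × ¬ SameEdge x y c d

    short-path : ∀ u v → ∃ λ ys → PathIn Avoiding u v ys × length ys ≤ L
    short-path u v with toPath (Detour.detour graph D (λ u v → fromReach (proj₁ diameter u v)) a b c d
                                  (3-connected a b c d) u v)
    ... | [] , path , _ = [] , path , z≤n
    ... | ys@(_ ∷ _) , path@((r ∷ _ , _) , _) , l = ys , path , ≤-trans l bound
      where
      open ≤-Reasoning
      expand : ∀ D → D + ((D + suc D) + (D + suc D)) ≡ 5 * D + 2 * 1
      expand = solve-∀
      bound : D + ((D + suc D) + (D + suc D)) ≤ L
      bound = begin
        D + ((D + suc D) + (D + suc D)) ≡⟨ expand D ⟩
        5 * D + 2 * 1                   ≤⟨ +-monoʳ-≤ (5 * D) (*-monoʳ-≤ 2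
                                             (n≢0⇒n>0 λ D≡0 → D≡0⇒edgeless D≡0 (proj₁ r))) ⟩
        5 * D + 2 * D                   ≡⟨ *-distribʳ-+ D 5 2 ⟨
        7 * D                           ≤⟨ *-monoʳ-≤ 7 D≤dEst ⟩
        L                               ∎

  suspect : ∃₂ λ a b → ∀ {u v} → ¬ SameEdge u v a b → isCorrupt (Adversary.corrupt adv) u v ≡ false
  suspect with Adversary.corrupt adv
  -- The pair `src , src` is no edge, so avoiding it forbids nothing.
  ... | nothing      = src , src , λ _ → refl
  ... | just (a , b) = a , b , isCorrupt-complete

  open Transport (4 * ω) narrow

  routes : ∀ {x y} → Edge graph x y →
    ∃ λ j → Σ (j < N) λ j<N → ex y x j ≡ true × (∃ λ ys → WalkIn (Usable j<N) src y ys × length ys ≤ L)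
  routes {x} {y} e =
    let a , b , honest = suspect
        ys , ((rs , end) , uniq) , l = short-path x y a b src y
        j , j<N , exj , open-edges = separates e
          ((Linked.map (λ (e , ¬xy , _) → e , ¬xy) rs , end) , uniq) l
    in j , j<N , exj , ys
     , (Linked.zipWith (λ ((e , _ , ¬ab) , exf) → e , honest ¬ab , exf) (rs , open-edges) , end) , l

  open Accept L routes

  -- Flooding takes `T₁` rounds, at most 1 + 2ℓ + L(1 + 4ω), and acceptance another L. With 1 ≤ ℓ
  -- and L ≤ ωL the sum is at most 6ωL + 3ℓ.
  T : ℕ
  T = 6 * (ω * L + ℓ)

  accepted-by-T : ∀ t v → T ≤ t → value m₀ ⊑ acc t v
  accepted-by-T t v T≤t with suspect
  -- Acceptance only has to avoid the controlled edge, which therefore fills both places. An empty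
  -- path means `v` is the source; a nonempty one supplies the edge for `1≤ω`.
  ... | a , b , honest with short-path a b a b src v
  ...   | [] , ((_ , refl) , _) , _ = acc-source t
  ...   | ys@(_ ∷ _) , ((rs@((e , _) ∷ _) , refl) , _) , l =
      ⊑-trans (accept-walk ys (Linked.map (λ (e , ¬ab , _) → e , honest ¬ab) rs) ≤-refl (acc-source T₁))
              (acc-stable (≤-trans deadline T≤t) v)
    where
    open ≤-Reasoning
    flatten : ∀ L ℓ ω → L + suc (ℓ * 2 + L * suc (4 * ω)) ≡ (1 + 2 * ℓ) + (1 * L + 1 * L + 4 * (ω * L))
    flatten = solve-∀
    gather : ∀ ℓ x → (ℓ + 2 * ℓ) + (x + x + 4 * x) ≡ 6 * x + 3 * ℓ
    gather = solve-∀
    deadline : length ys + T₁ ≤ T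
    deadline = begin
      length ys + suc (N * 2 + L * suc (4 * ω))
        ≤⟨ +-mono-≤ l (s≤s (+-monoˡ-≤ _ (*-monoˡ-≤ 2 (m⊓n≤m ℓ (Q * Q))))) ⟩
      L + suc (ℓ * 2 + L * suc (4 * ω))
        ≡⟨ flatten L ℓ ω ⟩
      (1 + 2 * ℓ) + (1 * L + 1 * L + 4 * (ω * L))
        ≤⟨ +-mono-≤ (+-monoˡ-≤ (2 * ℓ) ℓ>0) (+-monoˡ-≤ _ (+-mono-≤ L≤ωL L≤ωL)) ⟩
      (ℓ + 2 * ℓ) + (ω * L + ω * L + 4 * (ω * L))
        ≡⟨ gather ℓ (ω * L) ⟩
      6 * (ω * L) + 3 * ℓ
        ≤⟨ +-monoʳ-≤ (6 * (ω * L)) (*-monoˡ-≤ ℓ {3} {6} (s≤s (s≤s (s≤s z≤n)))) ⟩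
      6 * (ω * L) + 6 * ℓ
        ≡⟨ *-distribˡ-+ 6 (ω * L) ℓ ⟨
      T ∎
      where
      L≤ωL : 1 * L ≤ ω * L
      L≤ωL = *-monoˡ-≤ L (1≤ω e)

  broadcast : BroadcastWithin protocol S adv T
  broadcast = safe , live
    where
    safe : ∀ r v → out r v ≡ nothing ⊎ out r v ≡ just m₀
    safe r v with acc r v | acc-sound r v | out≡ r v
    ... | none    | _      | eq = inj₁ eq
    ... | value _ | value⊑ | eq = inj₂ eq

    live : ∀ r v → T ≤ r → out r v ≡ just m₀
    live r v T≤r = trans (out≡ r v)
      (cong decision (⊑-antisym (acc-sound r v) (accepted-by-T r v T≤r)))

theorem4 : ∀ (c cId cEst cM : ℕ) → 1 ≤ c →
    Σ Algorithm λ A → Σ ℕ λ cB → Σ ℕ λ C →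
    ∀ (n : ℕ) (S : Setup n) (D : ℕ) (adv : Adversary n) →
    ThreeEdgeConnected (Setup.graph S) →
    IsDiameter (Setup.graph S) D →
    D ≤ Setup.dEst S → Setup.dEst S ≤ c * D →
    Injective _≡_ _≡_ (Setup.ident S) →
    (∀ v → Fits cId n (Setup.ident S v)) →
    n ≤ Setup.nEst S → Setup.nEst S ≤ n ^ cEst →
    Fits cM n (Setup.m₀ S) →
    IsSubgraphFamily (Setup.graph S) (Setup.fam S) →
    IsCovering1 (Setup.graph S) (7 * Setup.dEst S) (Setup.fam S) →
    ValidAdversary (Setup.graph S) adv →
    BandwidthOK A S adv cB ×
    BroadcastWithin A S adv
    (C * (width (Setup.graph S) (Setup.fam S) * (7 * Setup.dEst S) + Setup.ℓ S))
theorem4 c cId cEst cM _ =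
  Protocol.protocol cId cM , (2 * cId + 2 * cM + 4) * suc cEst , 6 ,
  λ n S D adv 3-connected diameter D≤dEst _ ident-inj ident-fits n≤nEst nEst≤ m₀-fits subgraphs covering _ →
    let open Correct cId cEst cM S D adv 3-connected diameter D≤dEst ident-inj ident-fits
                     n≤nEst nEst≤ m₀-fits subgraphs covering
    in bandwidth , broadcast
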